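{- There is an absolute constant $c>0$ such that for every integer $n\geq 2$ and every $\varepsilon>\frac{1}{n}$, there exists a graph $G$ with $n$ vertices such that every $\varepsilon$-resistance sparsifier of $G$ has at least $c\, n/\sqrt{\varepsilon}$ edges (i.e. $\Omega(n/\sqrt{\varepsilon})$ edges).
   Context: Graphs are weighted undirected graphs $G=(V,E,w)$ with positive edge weights. The effective resistance between $s,t\in V$ is $R_{\mathrm{eff},G}(s,t)=\min\{\sum_{e\in E} f(e)^2/w(e) : f \text{ is a flow shipping one unit from } s \text{ to } t\}$ (infinite if no such flow exists). Given a graph $G=(V,E,w)$ and $\varepsilon>0$, an $\varepsilon$-resistance sparsifier of $G$ is any graph $G'=(V,E',w')$ on the same vertex set (not necessarily a subgraph of $G$, arbitrary positive weights allowed) such that $R_{\mathrm{eff},G'}(x,y)\in[(1-\varepsilon)R_{\mathrm{eff},G}(x,y),(1+\varepsilon)R_{\mathrm{eff},G}(x,y)]$ for all $x,y\in V$.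
   Formalization: The parameter ε and the edge weights of the sparsifiers are taken to be rational numbers instead of real numbers; the bound is stated in the squared form c²n² ≤ ε|E'|². -}

module Defs where

open import Data.Nat as ℕ using (ℕ; zero; suc)
open import Data.Fin using (Fin; zero; suc; toℕ)
import Data.Fin as F
open import Data.Integer using (+_)
open import Data.Rational using (ℚ; 0ℚ; 1ℚ; ½; _+_; _*_; _-_; _≤_; _<_; 1/_; _/_; >-nonZero)
open import Data.Rational.Properties using (_<?_)
open import Data.Product using (Σ; _×_; ∃; _,_)
open import Relation.Nullary using (yes; no; ¬_)
open import Relation.Binary.PropositionalEquality using (_≡_)
open import Function.Bundles using (_⇔_)

ΣQ : (n : ℕ) → (Fin n → ℚ) → ℚ
ΣQ zero    g = 0ℚ
ΣQ (suc n) g = g zero + ΣQ n (λ i → g (suc i))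

Σℕ : (n : ℕ) → (Fin n → ℕ) → ℕ
Σℕ zero    g = 0
Σℕ (suc n) g = g zero ℕ.+ Σℕ n (λ i → g (suc i))

ℕ→ℚ : ℕ → ℚ
ℕ→ℚ n = + n / 1

-- A weighted undirected (simple) graph on vertex set Fin n, given by a
-- symmetric weight function with zero diagonal; {u,v} is an edge iff W u v > 0.
record Graph (n : ℕ) : Set where
  field
    W       : Fin n → Fin n → ℚ
    nonneg  : ∀ u v → 0ℚ ≤ W u v
    symm    : ∀ u v → W u v ≡ W v u
    noLoops : ∀ u → W u u ≡ 0ℚ
open Graph public

edgeIndicator : ∀ {n} → Graph n → Fin n → Fin n → ℕ
edgeIndicator G u v with toℕ u ℕ.<? toℕ v | 0ℚ <? W G u v
... | yes _ | yes _ = 1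
... | _     | _     = 0

numEdges : ∀ {n} → Graph n → ℕ
numEdges {n} G = Σℕ n (λ u → Σℕ n (λ v → edgeIndicator G u v))

δ : ∀ {n} → Fin n → Fin n → ℚ
δ s u with u F.≟ s
... | yes _ = 1ℚ
... | no  _ = 0ℚ

record UnitFlow {n : ℕ} (G : Graph n) (s t : Fin n) : Set where
  field
    f        : Fin n → Fin n → ℚ
    antisym  : ∀ u v → f u v ≡ 0ℚ - f v u
    support  : ∀ u v → W G u v ≡ 0ℚ → f u v ≡ 0ℚ
    conserve : ∀ u → ΣQ n (λ v → f u v) ≡ δ s u - δ t u
open UnitFlow public

pairEnergy : ∀ {n} → (G : Graph n) → (Fin n → Fin n → ℚ) → Fin n → Fin n → ℚ
pairEnergy G f u v with 0ℚ <? W G u v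
... | yes p = (f u v * f u v) * (1/ W G u v) {{>-nonZero p}}
... | no  _ = 0ℚ

-- Energy Σ_{e ∈ E} f(e)^2 / w(e); each edge appears twice among ordered pairs.
energy : ∀ {n} {G : Graph n} {s t : Fin n} → UnitFlow G s t → ℚ
energy {n} {G} F = ½ * ΣQ n (λ u → ΣQ n (λ v → pairEnergy G (f F) u v))

FiniteRes : ∀ {n} → Graph n → Fin n → Fin n → Set
FiniteRes G s t = UnitFlow G s t

IsEffRes : ∀ {n} → Graph n → Fin n → Fin n → ℚ → Set
IsEffRes G s t r =
  (Σ (UnitFlow G s t) λ F → energy F ≡ r) × (∀ (F : UnitFlow G s t) → r ≤ energy F)

IsResistanceSparsifier : ∀ {n} → ℚ → Graph n → Graph n → Set
IsResistanceSparsifier ε G H =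
  ∀ x y →
    (FiniteRes G x y ⇔ FiniteRes H x y) ×
    (∀ r r' → IsEffRes G x y r → IsEffRes H x y r' →
       ((1ℚ - ε) * r ≤ r') × (r' ≤ (1ℚ + ε) * r))

{-# OPTIONS --safe #-}
module Submission where

open import Defs
open import Data.Fin using (Fin; zero; suc; toℕ)
import Data.Fin as F
open import Data.Fin.Properties using (suc-injective; toℕ-injective; any?)
import Data.Integer as ℤ
import Data.Integer.Properties as ℤ
open import Data.Nat using (ℕ; _≥_; zero; suc)
import Data.Nat as ℕ
import Data.Nat.Properties as ℕ
open import Data.Product using (Σ; _×_; _,_; proj₁; proj₂)
open import Data.Rational using (ℚ; 0ℚ; 1ℚ; ½; _+_; _*_; _-_; -_; 1/_; _<_; _≤_; Positive; nonNegative; positive; ≢-nonZero; >-nonZero)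
import Data.Rational as Q
open import Data.Rational.Properties
open import Data.Rational.Solver using (module +-*-Solver)
open import Data.Rational.Unnormalised as ℚᵘ using (mkℚᵘ; *≡*)
import Data.Rational.Unnormalised.Properties as ℚᵘ
open import Data.Sum using (_⊎_; inj₁; inj₂; [_,_]′)
open import Function using (_∘_)
open import Function.Bundles using (Equivalence)
open import Relation.Binary.PropositionalEquality using (_≡_; _≢_; refl; sym; trans; cong; cong₂; subst; subst₂; module ≡-Reasoning)
open import Relation.Nullary using (Dec; yes; no; ¬_; contradiction)
open import Relation.Nullary.Decidable using (toWitness)
open +-*-Solver using (solve; _:=_; _:+_; _:*_; _:-_; con)

-- Take G = Kₙ with unit weights, where all resistances are 2/n. In a sparsifier H write w for the
-- weights at a vertex u, d = Σ w, S = Σ w², N for the number of neighbours of u. The diagonal of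
-- LRL = -2L reads 2 d Σ wₓ R(u,x) - ΣΣ wₓ w_y R(x,y) = 2d; inserting R = (1 ± ε) 2/n for distinct
-- vertices bounds n d - d² from below by roughly S, and S ≥ d²/N. If u, v are not adjacent, the
-- dipole a (δᵤ - δᵥ) as a test potential gives R(u,v) ≥ 4a - a² (dᵤ + dᵥ), so that the larger of
-- dᵤ, dᵥ is at least n/(1+ε). Together, one of two non-adjacent vertices has N ≥ 1/(4ε). Hence H has
-- at least n/(32 ε) edges, which is enough for ε ≤ 1; for ε ≥ 1 it suffices that H is connected.

-- Ordered field arithmetic

0≤-+ : ∀ {p q} → 0ℚ ≤ p → 0ℚ ≤ q → 0ℚ ≤ p + q
0≤-+ = +-mono-≤

0≤-* : ∀ {p q} → 0ℚ ≤ p → 0ℚ ≤ q → 0ℚ ≤ p * q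
0≤-* {p} {q} 0≤p 0≤q =
  subst (_≤ p * q) (*-zeroʳ p) (*-monoˡ-≤-nonNeg p {{nonNegative 0≤p}} 0≤q)

0<-* : ∀ {p q} → 0ℚ < p → 0ℚ < q → 0ℚ < p * q
0<-* {p} {q} 0<p 0<q =
  subst (_< p * q) (*-zeroʳ p) (*-monoʳ-<-pos p {{positive 0<p}} 0<q)

p≤q⇒0≤q-p : ∀ {p q} → p ≤ q → 0ℚ ≤ q - p
p≤q⇒0≤q-p {p} {q} p≤q = subst (_≤ q - p) (+-inverseʳ p) (+-monoˡ-≤ (- p) p≤q)

p<q⇒0<q-p : ∀ {p q} → p < q → 0ℚ < q - p
p<q⇒0<q-p {p} {q} p<q = subst (_< q - p) (+-inverseʳ p) (+-monoˡ-< (- p) p<q)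

0≤q-p⇒p≤q : ∀ {p q} → 0ℚ ≤ q - p → p ≤ q
0≤q-p⇒p≤q {p} {q} 0≤q-p = subst₂ _≤_ (+-identityˡ p)
  (solve 2 (λ p q → (q :- p) :+ p := q) refl p q) (+-monoˡ-≤ p 0≤q-p)

0≤p² : ∀ p → 0ℚ ≤ p * p
0≤p² p with ≤-total 0ℚ p
... | inj₁ 0≤p = 0≤-* 0≤p 0≤p
... | inj₂ p≤0 = subst (0ℚ ≤_) (solve 1 (λ p → (con 0ℚ :- p) :* (con 0ℚ :- p) := p :* p) refl p)
                   (0≤-* (p≤q⇒0≤q-p p≤0) (p≤q⇒0≤q-p p≤0))

p≡-p⇒p≡0 : ∀ {p} → p ≡ 0ℚ - p → p ≡ 0ℚ
p≡-p⇒p≡0 {p} p≡-p = begin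
  p                ≡⟨ solve 1 (λ p → p := con ½ :* (p :+ p)) refl p ⟩
  ½ * (p + p)      ≡⟨ cong (λ z → ½ * (p + z)) p≡-p ⟩
  ½ * (p + (0ℚ - p)) ≡⟨ solve 1 (λ p → con ½ :* (p :+ (con 0ℚ :- p)) := con 0ℚ) refl p ⟩
  0ℚ ∎
  where open ≡-Reasoning

*-mono-≤-nonNeg : ∀ {p q r s} → 0ℚ ≤ p → 0ℚ ≤ s → p ≤ q → r ≤ s → p * r ≤ q * s
*-mono-≤-nonNeg {p} {q} {r} {s} 0≤p 0≤s p≤q r≤s =
  ≤-trans (*-monoˡ-≤-nonNeg p {{nonNegative 0≤p}} r≤s) (*-monoʳ-≤-nonNeg s {{nonNegative 0≤s}} p≤q)

-- Finite sums

ΣQ-cong : ∀ n {f g : Fin n → ℚ} → (∀ i → f i ≡ g i) → ΣQ n f ≡ ΣQ n g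
ΣQ-cong zero    f≡g = refl
ΣQ-cong (suc n) f≡g = cong₂ _+_ (f≡g zero) (ΣQ-cong n (f≡g ∘ suc))

ΣQ-zero : ∀ n {f : Fin n → ℚ} → (∀ i → f i ≡ 0ℚ) → ΣQ n f ≡ 0ℚ
ΣQ-zero zero    f≡0 = refl
ΣQ-zero (suc n) f≡0 = cong₂ _+_ (f≡0 zero) (ΣQ-zero n (f≡0 ∘ suc))

ΣQ-+ : ∀ n (f g : Fin n → ℚ) → ΣQ n (λ i → f i + g i) ≡ ΣQ n f + ΣQ n g
ΣQ-+ zero    f g = refl
ΣQ-+ (suc n) f g = trans (cong (f zero + g zero +_) (ΣQ-+ n (f ∘ suc) (g ∘ suc)))
  (solve 4 (λ a b c d → (a :+ b) :+ (c :+ d) := (a :+ c) :+ (b :+ d)) refl (f zero) (g zero) _ _)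

ΣQ-*ˡ : ∀ n c (f : Fin n → ℚ) → ΣQ n (λ i → c * f i) ≡ c * ΣQ n f
ΣQ-*ˡ zero    c f = sym (*-zeroʳ c)
ΣQ-*ˡ (suc n) c f = trans (cong (c * f zero +_) (ΣQ-*ˡ n c (f ∘ suc))) (sym (*-distribˡ-+ c _ _))

ΣQ-*ʳ : ∀ n c (f : Fin n → ℚ) → ΣQ n (λ i → f i * c) ≡ ΣQ n f * c
ΣQ-*ʳ n c f = trans (ΣQ-cong n (λ i → *-comm (f i) c)) (trans (ΣQ-*ˡ n c f) (*-comm c _))

ΣQ-sub : ∀ n (f g : Fin n → ℚ) → ΣQ n (λ i → f i - g i) ≡ ΣQ n f - ΣQ n g
ΣQ-sub zero    f g = refl
ΣQ-sub (suc n) f g = trans (cong (f zero - g zero +_) (ΣQ-sub n (f ∘ suc) (g ∘ suc)))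
  (solve 4 (λ a b c d → (a :- b) :+ (c :- d) := (a :+ c) :- (b :+ d)) refl (f zero) (g zero) _ _)

ΣQ-swap : ∀ m n (f : Fin m → Fin n → ℚ) →
  ΣQ m (λ i → ΣQ n (f i)) ≡ ΣQ n (λ j → ΣQ m (λ i → f i j))
ΣQ-swap zero    n f = sym (ΣQ-zero n (λ _ → refl))
ΣQ-swap (suc m) n f = trans (cong (ΣQ n (f zero) +_) (ΣQ-swap m n (f ∘ suc)))
  (sym (ΣQ-+ n (f zero) (λ j → ΣQ m (λ i → f (suc i) j))))

ΣQ-mono : ∀ n {f g : Fin n → ℚ} → (∀ i → f i ≤ g i) → ΣQ n f ≤ ΣQ n g
ΣQ-mono zero    f≤g = ≤-refl
ΣQ-mono (suc n) f≤g = +-mono-≤ (f≤g zero) (ΣQ-mono n (f≤g ∘ suc))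

ΣQ-nonneg : ∀ n {f : Fin n → ℚ} → (∀ i → 0ℚ ≤ f i) → 0ℚ ≤ ΣQ n f
ΣQ-nonneg zero    0≤f = ≤-refl
ΣQ-nonneg (suc n) 0≤f = 0≤-+ (0≤f zero) (ΣQ-nonneg n (0≤f ∘ suc))

ΣQ-term≤ : ∀ n {f : Fin n → ℚ} → (∀ i → 0ℚ ≤ f i) → ∀ i → f i ≤ ΣQ n f
ΣQ-term≤ (suc n) {f} 0≤f zero    = subst (_≤ ΣQ (suc n) f) (+-identityʳ (f zero))
  (+-monoʳ-≤ (f zero) (ΣQ-nonneg n (0≤f ∘ suc)))
ΣQ-term≤ (suc n) {f} 0≤f (suc i) = subst (_≤ ΣQ (suc n) f) (+-identityˡ (f (suc i)))
  (+-mono-≤ (0≤f zero) (ΣQ-term≤ n (0≤f ∘ suc) i))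

ΣQ≡0⇒≡0 : ∀ n {f : Fin n → ℚ} → (∀ i → 0ℚ ≤ f i) → ΣQ n f ≡ 0ℚ → ∀ i → f i ≡ 0ℚ
ΣQ≡0⇒≡0 n 0≤f Σf≡0 i = ≤-antisym (subst (_ ≤_) Σf≡0 (ΣQ-term≤ n 0≤f i)) (0≤f i)

ΣQ-single : ∀ n (f : Fin n → ℚ) s → (∀ i → i ≢ s → f i ≡ 0ℚ) → ΣQ n f ≡ f s
ΣQ-single (suc n) f zero    f≡0 =
  trans (cong (f zero +_) (ΣQ-zero n (λ i → f≡0 (suc i) (λ ())))) (+-identityʳ _)
ΣQ-single (suc n) f (suc s) f≡0 =
  trans (cong₂ _+_ (f≡0 zero (λ ())) (ΣQ-single n (f ∘ suc) s (λ i i≢s → f≡0 (suc i) (i≢s ∘ suc-injective))))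
    (+-identityˡ _)

-- Embedding of the natural numbers

-- The quotient in `ℕ→ℚ` is normalised by a gcd, so the equation is checked on unnormalised
-- fractions; `frac` stores the denominator minus one, hence the 0.
ℕ→ℚ-+ : ∀ m n → ℕ→ℚ (m ℕ.+ n) ≡ ℕ→ℚ m + ℕ→ℚ n
ℕ→ℚ-+ m n = toℚᵘ-injective (begin
  Q.toℚᵘ (ℕ→ℚ (m ℕ.+ n))            ≈⟨ toℚᵘ-fromℚᵘ (frac (m ℕ.+ n)) ⟩
  frac (m ℕ.+ n)                    ≈⟨ *≡* (cong (ℤ._* ℤ.+ 1) (sym (cong₂ ℤ._+_ (ℤ.*-identityʳ (ℤ.+ m)) (ℤ.*-identityʳ (ℤ.+ n))))) ⟩
  frac m ℚᵘ.+ frac n                ≈⟨ ℚᵘ.+-cong (toℚᵘ-fromℚᵘ (frac m)) (toℚᵘ-fromℚᵘ (frac n)) ⟨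
  Q.toℚᵘ (ℕ→ℚ m) ℚᵘ.+ Q.toℚᵘ (ℕ→ℚ n) ≈⟨ toℚᵘ-homo-+ (ℕ→ℚ m) (ℕ→ℚ n) ⟨
  Q.toℚᵘ (ℕ→ℚ m + ℕ→ℚ n)            ∎)
  where
  open ℚᵘ.≃-Reasoning
  frac : ℕ → ℚᵘ.ℚᵘ
  frac k = mkℚᵘ (ℤ.+ k) 0

0≤ℕ→ℚ : ∀ n → 0ℚ ≤ ℕ→ℚ n
0≤ℕ→ℚ n = nonNegative⁻¹ (ℕ→ℚ n) {{normalize-nonNeg n 1}}

ℕ→ℚ-mono : ∀ {m n} → m ℕ.≤ n → ℕ→ℚ m ≤ ℕ→ℚ n
ℕ→ℚ-mono {m} {n} m≤n = begin
  ℕ→ℚ m                       ≡⟨ +-identityʳ (ℕ→ℚ m) ⟨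
  ℕ→ℚ m + 0ℚ                  ≤⟨ +-monoʳ-≤ (ℕ→ℚ m) (0≤ℕ→ℚ (n ℕ.∸ m)) ⟩
  ℕ→ℚ m + ℕ→ℚ (n ℕ.∸ m)       ≡⟨ ℕ→ℚ-+ m (n ℕ.∸ m) ⟨
  ℕ→ℚ (m ℕ.+ (n ℕ.∸ m))       ≡⟨ cong ℕ→ℚ (ℕ.m+[n∸m]≡n m≤n) ⟩
  ℕ→ℚ n                       ∎
  where open ≤-Reasoning

ΣQ-1 : ∀ n → ΣQ n (λ _ → 1ℚ) ≡ ℕ→ℚ n
ΣQ-1 zero    = refl
ΣQ-1 (suc n) = trans (cong (1ℚ +_) (ΣQ-1 n)) (sym (ℕ→ℚ-+ 1 n))

ΣQ-Σℕ : ∀ n (g : Fin n → ℕ) → ΣQ n (ℕ→ℚ ∘ g) ≡ ℕ→ℚ (Σℕ n g)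
ΣQ-Σℕ zero    g = refl
ΣQ-Σℕ (suc n) g = trans (cong (ℕ→ℚ (g zero) +_) (ΣQ-Σℕ n (g ∘ suc))) (sym (ℕ→ℚ-+ (g zero) _))

-- Kronecker delta and dipoles

δ-refl : ∀ {n} (s : Fin n) → δ s s ≡ 1ℚ
δ-refl s with s F.≟ s
... | yes _  = refl
... | no s≢s = contradiction refl s≢s

δ-≢ : ∀ {n} {s u : Fin n} → u ≢ s → δ s u ≡ 0ℚ
δ-≢ {s = s} {u} u≢s with u F.≟ s
... | yes u≡s = contradiction u≡s u≢s
... | no _    = refl

δ-sym : ∀ {n} (s u : Fin n) → δ s u ≡ δ u s
δ-sym s u with u F.≟ s
... | yes refl = sym (δ-refl s)
... | no u≢s   = sym (δ-≢ (u≢s ∘ sym))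

ΣQ-δ : ∀ n s (g : Fin n → ℚ) → ΣQ n (λ u → δ s u * g u) ≡ g s
ΣQ-δ n s g = begin
  ΣQ n (λ u → δ s u * g u) ≡⟨ ΣQ-single n _ s (λ u u≢s → trans (cong (_* g u) (δ-≢ u≢s)) (*-zeroˡ (g u))) ⟩
  δ s s * g s              ≡⟨ cong (_* g s) (δ-refl s) ⟩
  1ℚ * g s                 ≡⟨ *-identityˡ (g s) ⟩
  g s                      ∎
  where open ≡-Reasoning

-- Pairing with the demand of a unit flow reads off a potential drop; this is how conservation laws
-- become potential differences.
ΣQ-δ-dipole : ∀ n s t (ψ : Fin n → ℚ) → ΣQ n (λ u → ψ u * (δ s u - δ t u)) ≡ ψ s - ψ t
ΣQ-δ-dipole n s t ψ = begin
  ΣQ n (λ u → ψ u * (δ s u - δ t u))       ≡⟨ ΣQ-cong n (λ u → solve 3 (λ p a b → p :* (a :- b) := a :* p :- b :* p) refl (ψ u) (δ s u) (δ t u)) ⟩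
  ΣQ n (λ u → δ s u * ψ u - δ t u * ψ u)   ≡⟨ ΣQ-sub n _ _ ⟩
  ΣQ n (λ u → δ s u * ψ u) - ΣQ n (λ u → δ t u * ψ u) ≡⟨ cong₂ _-_ (ΣQ-δ n s ψ) (ΣQ-δ n t ψ) ⟩
  ψ s - ψ t ∎
  where open ≡-Reasoning

-- Potentials

-- The weighted graph Laplacian. In this difference form the loops created by eliminating a vertex
-- contribute zero.
lap : ∀ {n} → (Fin n → Fin n → ℚ) → (Fin n → ℚ) → Fin n → ℚ
lap {n} W φ x = ΣQ n (λ y → W x y * (φ x - φ y))

lap-sub : ∀ {n} (W : Fin n → Fin n → ℚ) φ ψ x → lap W (λ z → φ z - ψ z) x ≡ lap W φ x - lap W ψ x
lap-sub {n} W φ ψ x = trans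
  (ΣQ-cong n (λ y → solve 5 (λ w p q r s → w :* ((p :- r) :- (q :- s)) := w :* (p :- q) :- w :* (r :- s))
    refl (W x y) (φ x) (φ y) (ψ x) (ψ y)))
  (ΣQ-sub n _ _)

lap-row : ∀ n (w φ : Fin n → ℚ) p → ΣQ n (λ y → w y * (p - φ y)) ≡ ΣQ n w * p - ΣQ n (λ y → w y * φ y)
lap-row n w φ p = begin
  ΣQ n (λ y → w y * (p - φ y))           ≡⟨ ΣQ-cong n (λ y → solve 3 (λ w p q → w :* (p :- q) := w :* p :- w :* q) refl (w y) p (φ y)) ⟩
  ΣQ n (λ y → w y * p - w y * φ y)       ≡⟨ ΣQ-sub n _ _ ⟩
  ΣQ n (λ y → w y * p) - ΣQ n (λ y → w y * φ y) ≡⟨ cong (λ z → z - _) (ΣQ-*ʳ n p w) ⟩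
  ΣQ n w * p - ΣQ n (λ y → w y * φ y)    ∎
  where open ≡-Reasoning

-- The scalar i stands for 1/d; if the star is empty then d = 0 and i = 0 serves.
starInverse : ∀ n (w g : Fin n → ℚ) → (∀ y → 0ℚ ≤ w y) → (∀ y → w y ≡ 0ℚ → g y ≡ 0ℚ) →
  Σ ℚ λ i → (0ℚ ≤ i) × (∀ y → w y * (ΣQ n w * i) ≡ w y) × (∀ y → g y * (ΣQ n w * i) ≡ g y)
starInverse n w g 0≤w supp with ΣQ n w ≟ 0ℚ
... | yes d≡0 = 0ℚ , ≤-refl , (λ y → absorb (w≡0 y)) , (λ y → absorb (supp y (w≡0 y)))
  where
  w≡0 : ∀ y → w y ≡ 0ℚ
  w≡0 = ΣQ≡0⇒≡0 n 0≤w d≡0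
  absorb : ∀ {p q} → p ≡ 0ℚ → p * q ≡ p
  absorb {q = q} refl = *-zeroˡ q
... | no d≢0 = 1/d , 0≤1/d , (λ y → absorb (w y)) , (λ y → absorb (g y))
  where
  d : ℚ
  d = ΣQ n w
  instance
    d-pos : Positive d
    d-pos = nonNeg∧nonZero⇒pos d {{nonNegative (ΣQ-nonneg n 0≤w)}} {{≢-nonZero d≢0}}
  1/d : ℚ
  1/d = (1/ d) {{pos⇒nonZero d}}
  0≤1/d : 0ℚ ≤ 1/d
  0≤1/d = <⇒≤ (positive⁻¹ 1/d {{1/pos⇒pos d}})
  absorb : ∀ p → p * (d * 1/d) ≡ p
  absorb p = trans (cong (p *_) (*-inverseʳ d {{pos⇒nonZero d}})) (*-identityʳ p)

-- Gaussian elimination of one vertex is the star-mesh transformation; the flow is rerouted along it,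
-- so that solvability of the smaller system is inherited.
potential : ∀ n (W f : Fin n → Fin n → ℚ) →
  (∀ u v → 0ℚ ≤ W u v) → (∀ u v → W u v ≡ W v u) →
  (∀ u v → f u v ≡ 0ℚ - f v u) → (∀ u v → W u v ≡ 0ℚ → f u v ≡ 0ℚ) →
  Σ (Fin n → ℚ) λ φ → ∀ x → lap W φ x ≡ ΣQ n (f x)
potential zero    W f W-nonneg W-symm f-anti f-supp = (λ ()) , (λ ())
potential (suc n) W f W-nonneg W-symm f-anti f-supp
  with starInverse n (W zero ∘ suc) (f zero ∘ suc) (λ y → W-nonneg zero (suc y)) (λ y → f-supp zero (suc y))
... | i , 0≤i , w-absorb , g-absorb = φ , solves
  where
  w g : Fin n → ℚ
  w y = W zero (suc y)
  g y = f zero (suc y)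
  d b : ℚ
  d = ΣQ n w
  b = ΣQ n g
  W' f' : Fin n → Fin n → ℚ
  W' x y = W (suc x) (suc y) + w x * w y * i
  -- Summed over y, the correction charges the net outflow `b` of the removed vertex to `x` in
  -- proportion `w x * i` and subtracts `g x`: exactly the right-hand side that elimination
  -- produces.
  f' x y = f (suc x) (suc y) + (g y * w x - g x * w y) * i

  star-nonneg : ∀ x y → 0ℚ ≤ w x * w y * i
  star-nonneg x y = 0≤-* (0≤-* (W-nonneg zero (suc x)) (W-nonneg zero (suc y))) 0≤i

  W'-nonneg : ∀ x y → 0ℚ ≤ W' x y
  W'-nonneg x y = 0≤-+ (W-nonneg (suc x) (suc y)) (star-nonneg x y)

  W'-symm : ∀ x y → W' x y ≡ W' y x
  W'-symm x y = cong₂ _+_ (W-symm (suc x) (suc y)) (cong (_* i) (*-comm (w x) (w y)))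

  f'-anti : ∀ x y → f' x y ≡ 0ℚ - f' y x
  f'-anti x y = trans (cong (_+ (g y * w x - g x * w y) * i) (f-anti (suc x) (suc y)))
    (solve 6 (λ h gx gy wx wy i →
        (con 0ℚ :- h) :+ (gy :* wx :- gx :* wy) :* i := con 0ℚ :- (h :+ (gx :* wy :- gy :* wx) :* i))
      refl (f (suc y) (suc x)) (g x) (g y) (w x) (w y) i)

  f'-supp : ∀ x y → W' x y ≡ 0ℚ → f' x y ≡ 0ℚ
  f'-supp x y W'≡0 = cong₂ _+_ (f-supp (suc x) (suc y) W≡0) mesh≡0
    where
    W≤W' : W (suc x) (suc y) ≤ W' x y
    W≤W' = subst (_≤ W' x y) (+-identityʳ _) (+-monoʳ-≤ (W (suc x) (suc y)) (star-nonneg x y))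
    W≡0 : W (suc x) (suc y) ≡ 0ℚ
    W≡0 = ≤-antisym (subst (_ ≤_) W'≡0 W≤W') (W-nonneg (suc x) (suc y))
    wwi≡0 : w x * w y * i ≡ 0ℚ
    wwi≡0 = trans (sym (+-identityˡ _)) (trans (cong (_+ w x * w y * i) (sym W≡0)) W'≡0)
    wx-zero : ∀ {x y} → w x ≡ 0ℚ → (g y * w x - g x * w y) * i ≡ 0ℚ
    wx-zero {x} {y} wx≡0 = trans (cong₂ (λ p q → (g y * p - q * w y) * i) wx≡0 (f-supp zero (suc x) wx≡0))
      (solve 3 (λ gy wy i → (gy :* con 0ℚ :- con 0ℚ :* wy) :* i := con 0ℚ) refl (g y) (w y) i)
    mesh≡0 : (g y * w x - g x * w y) * i ≡ 0ℚ
    -- The mesh weight is a product of three nonnegative factors, so one of them vanishes, and each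
    -- of them kills the rerouted flow.
    mesh≡0 with w x ≟ 0ℚ | w y ≟ 0ℚ | i ≟ 0ℚ
    ... | yes wx≡0 | _ | _ = wx-zero wx≡0
    ... | no _ | yes wy≡0 | _ = trans
      (solve 5 (λ gx gy wx wy i → (gy :* wx :- gx :* wy) :* i := con 0ℚ :- (gx :* wy :- gy :* wx) :* i)
         refl (g x) (g y) (w x) (w y) i)
      (cong (λ z → 0ℚ - z) (wx-zero wy≡0))
    ... | no _ | no _ | yes i≡0 = trans (cong ((g y * w x - g x * w y) *_) i≡0) (*-zeroʳ (g y * w x - g x * w y))
    ... | no wx≢0 | no wy≢0 | no i≢0 = contradiction (sym wwi≡0) (<⇒≢
      (0<-* (0<-* (pos (W-nonneg _ _) wx≢0) (pos (W-nonneg _ _) wy≢0)) (pos 0≤i i≢0)))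
      where
      pos : ∀ {p} → 0ℚ ≤ p → p ≢ 0ℚ → 0ℚ < p
      pos {p} 0≤p p≢0 = positive⁻¹ p {{nonNeg∧nonZero⇒pos p {{nonNegative 0≤p}} {{≢-nonZero p≢0}}}}

  reduced = potential n W' f' W'-nonneg W'-symm f'-anti f'-supp
  φ' : Fin n → ℚ
  φ' = proj₁ reduced
  P p : ℚ
  P = ΣQ n (λ y → w y * φ' y)
  -- Back-substitution: the equation `d * p - P = b` of the removed vertex, solved for its
  -- potential.
  p = i * (b + P)

  φ : Fin (suc n) → ℚ
  φ zero    = p
  φ (suc x) = φ' x

  -- The factor `d * i` is 1 unless the star is empty; then it is 0, but so are `b` and `P`. Hence
  -- it is absorbed rather than cancelled.
  ΣQ-absorb : ∀ (h : Fin n → ℚ) → (∀ y → h y * (d * i) ≡ h y) → ΣQ n h * (d * i) ≡ ΣQ n h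
  ΣQ-absorb h h-absorb = trans (sym (ΣQ-*ʳ n (d * i) h)) (ΣQ-cong n h-absorb)

  b-absorb : b * (d * i) ≡ b
  b-absorb = ΣQ-absorb g g-absorb

  P-absorb : P * (d * i) ≡ P
  P-absorb = ΣQ-absorb _ (λ y → trans
    (solve 4 (λ w q d i → w :* q :* (d :* i) := w :* (d :* i) :* q) refl (w y) (φ' y) d i)
    (cong (_* φ' y) (w-absorb y)))

  open ≡-Reasoning

  solves : ∀ x → lap W φ x ≡ ΣQ (suc n) (f x)
  solves zero = begin
    W zero zero * (p - p) + ΣQ n (λ y → w y * (p - φ' y))
      ≡⟨ cong (W zero zero * (p - p) +_) (lap-row n w φ' p) ⟩
    W zero zero * (p - p) + (d * p - P)
      ≡⟨ solve 5 (λ W i d b P → W :* (i :* (b :+ P) :- i :* (b :+ P)) :+ (d :* (i :* (b :+ P)) :- P)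
           := b :* (d :* i) :+ (P :* (d :* i) :- P)) refl (W zero zero) i d b P ⟩
    b * (d * i) + (P * (d * i) - P)
      ≡⟨ cong₂ (λ b' P' → b' + (P' - P)) b-absorb P-absorb ⟩
    b + (P - P)
      ≡⟨ solve 2 (λ b P → b :+ (P :- P) := con 0ℚ :+ b) refl b P ⟩
    0ℚ + b
      -- Antisymmetry makes the flow vanish on the diagonal.
      ≡⟨ cong (_+ b) (p≡-p⇒p≡0 (f-anti zero zero)) ⟨
    f zero zero + b ∎
  solves (suc x) = begin
    W (suc x) zero * (φ' x - p) + A
      ≡⟨ cong (λ z → z * (φ' x - p) + A) (W-symm (suc x) zero) ⟩
    w x * (φ' x - p) + A
      ≡⟨ solve 4 (λ w q p A → w :* (q :- p) :+ A := A :+ w :* q :- w :* p) refl (w x) (φ' x) p A ⟩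
    A + w x * φ' x - w x * p
      -- Inserting `d * i` exposes the Laplacian of the reduced graph, to which `reduced-eq`
      -- applies.
      ≡⟨ cong (λ z → A + z * φ' x - w x * p) (w-absorb x) ⟨
    A + w x * (d * i) * φ' x - w x * p
      ≡⟨ solve 7 (λ A w d i q b P → A :+ w :* (d :* i) :* q :- w :* (i :* (b :+ P))
           := (A :+ (d :* q :- P) :* (w :* i)) :- b :* (w :* i)) refl A (w x) d i (φ' x) b P ⟩
    (A + (d * φ' x - P) * (w x * i)) - b * (w x * i)
      ≡⟨ cong (λ z → z - b * (w x * i)) reduced-eq ⟩
    (Fx + (b * w x - g x * d) * i) - b * (w x * i)
      ≡⟨ solve 6 (λ F b w g d i → (F :+ (b :* w :- g :* d) :* i) :- b :* (w :* i) := F :- g :* (d :* i))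
           refl Fx b (w x) (g x) d i ⟩
    Fx - g x * (d * i)
      ≡⟨ cong (λ z → Fx - z) (g-absorb x) ⟩
    Fx - g x
      ≡⟨ solve 2 (λ F g → F :- g := (con 0ℚ :- g) :+ F) refl Fx (g x) ⟩
    (0ℚ - g x) + Fx
      ≡⟨ cong (_+ Fx) (f-anti (suc x) zero) ⟨
    f (suc x) zero + Fx ∎
    where
    A Fx : ℚ
    A = ΣQ n (λ y → W (suc x) (suc y) * (φ' x - φ' y))
    Fx = ΣQ n (λ y → f (suc x) (suc y))

    reduced-eq : A + (d * φ' x - P) * (w x * i) ≡ Fx + (b * w x - g x * d) * i
    reduced-eq = begin
      A + (d * φ' x - P) * (w x * i)
        ≡⟨ cong (λ z → A + z * (w x * i)) (lap-row n w φ' (φ' x)) ⟨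
      A + ΣQ n (λ y → w y * (φ' x - φ' y)) * (w x * i)
        ≡⟨ cong (A +_) (ΣQ-*ʳ n (w x * i) _) ⟨
      A + ΣQ n (λ y → w y * (φ' x - φ' y) * (w x * i))
        ≡⟨ ΣQ-+ n _ _ ⟨
      ΣQ n (λ y → W (suc x) (suc y) * (φ' x - φ' y) + w y * (φ' x - φ' y) * (w x * i))
        ≡⟨ ΣQ-cong n (λ y → solve 5 (λ W q wy wx i → W :* q :+ wy :* q :* (wx :* i) := (W :+ wx :* wy :* i) :* q)
             refl (W (suc x) (suc y)) (φ' x - φ' y) (w y) (w x) i) ⟩
      lap W' φ' x
        ≡⟨ proj₂ reduced x ⟩
      ΣQ n (f' x)
        ≡⟨ ΣQ-+ n _ _ ⟩
      Fx + ΣQ n (λ y → (g y * w x - g x * w y) * i)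
        ≡⟨ cong (Fx +_) (ΣQ-*ʳ n i _) ⟩
      Fx + ΣQ n (λ y → g y * w x - g x * w y) * i
        ≡⟨ cong (λ z → Fx + z * i) (ΣQ-sub n _ _) ⟩
      Fx + (ΣQ n (λ y → g y * w x) - ΣQ n (λ y → g x * w y)) * i
        ≡⟨ cong₂ (λ y z → Fx + (y - z) * i) (ΣQ-*ʳ n (w x) g) (ΣQ-*ˡ n (g x) w) ⟩
      Fx + (b * w x - g x * d) * i ∎

-- Effective resistance

-- Antisymmetry moves the `ψ v` half of the sum onto `ψ u`. Ordered pairs meet each edge twice,
-- hence `S + S`; the factor ½ in `energy` compensates.
sum-by-parts : ∀ n (h : Fin n → Fin n → ℚ) (ψ : Fin n → ℚ) → (∀ u v → h u v ≡ 0ℚ - h v u) →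
  let S = ΣQ n (λ u → ψ u * ΣQ n (h u)) in
  ΣQ n (λ u → ΣQ n (λ v → h u v * (ψ u - ψ v))) ≡ S + S
sum-by-parts n h ψ h-anti = begin
  ΣQ n (λ u → ΣQ n (λ v → h u v * (ψ u - ψ v)))
    ≡⟨ ΣQ-cong n (λ u → ΣQ-cong n (λ v → trans
         (solve 3 (λ h p q → h :* (p :- q) := p :* h :+ (con 0ℚ :- h) :* q) refl (h u v) (ψ u) (ψ v))
         (cong (ψ u * h u v +_) (trans (cong (_* ψ v) (sym (h-anti v u))) (*-comm (h v u) (ψ v)))))) ⟩
  ΣQ n (λ u → ΣQ n (λ v → ψ u * h u v + ψ v * h v u))
    ≡⟨ ΣQ-cong n (λ u → ΣQ-+ n _ _) ⟩
  ΣQ n (λ u → ΣQ n (λ v → ψ u * h u v) + ΣQ n (λ v → ψ v * h v u))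
    ≡⟨ ΣQ-+ n _ _ ⟩
  ΣQ n (λ u → ΣQ n (λ v → ψ u * h u v)) + ΣQ n (λ u → ΣQ n (λ v → ψ v * h v u))
    ≡⟨ cong (ΣQ n (λ u → ΣQ n (λ v → ψ u * h u v)) +_) (ΣQ-swap n n _) ⟩
  ΣQ n (λ u → ΣQ n (λ v → ψ u * h u v)) + ΣQ n (λ v → ΣQ n (λ u → ψ v * h v u))
    ≡⟨ cong (λ z → z + z) (ΣQ-cong n (λ u → ΣQ-*ˡ n (ψ u) (h u))) ⟩
  _ ∎
  where open ≡-Reasoning

module _ {n : ℕ} (G : Graph n) where

  -- Ohm's law: the current driven by the potential `φ`.
  gradient : (Fin n → ℚ) → Fin n → Fin n → ℚ
  gradient φ u v = W G u v * (φ u - φ v)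

  gradient-anti : ∀ φ u v → gradient φ u v ≡ 0ℚ - gradient φ v u
  gradient-anti φ u v = trans (cong (_* (φ u - φ v)) (symm G u v))
    (solve 3 (λ w p q → w :* (p :- q) := con 0ℚ :- w :* (q :- p)) refl (W G v u) (φ u) (φ v))

  -- The quadratic form of the Laplacian; by `sum-by-parts` it is half the sum of w (ψ u - ψ v)²
  -- over ordered pairs.
  dirichlet : (Fin n → ℚ) → ℚ
  dirichlet ψ = ΣQ n (λ u → ψ u * lap (W G) ψ u)

  ≮⇒W≡0 : ∀ u v → ¬ 0ℚ < W G u v → W G u v ≡ 0ℚ
  ≮⇒W≡0 u v ≮ = ≤-antisym (≮⇒≥ ≮) (nonneg G u v)

  -- Completing the square in f²/w - 2 f Δ + w Δ².
  pairEnergy-bound : ∀ f (ψ : Fin n → ℚ) → (∀ u v → W G u v ≡ 0ℚ → f u v ≡ 0ℚ) → ∀ u v →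
    let Δ = ψ u - ψ v in (f u v * Δ + f u v * Δ) - gradient ψ u v * Δ ≤ pairEnergy G f u v
  pairEnergy-bound f ψ supp u v with 0ℚ <? W G u v
  ... | yes 0<w = 0≤q-p⇒p≤q (subst (0ℚ ≤_) square (0≤-* 0≤w⁻¹ (0≤p² (f u v - w * Δ))))
    where
    w Δ w⁻¹ : ℚ
    w = W G u v
    Δ = ψ u - ψ v
    w⁻¹ = (1/ w) {{>-nonZero 0<w}}
    0≤w⁻¹ : 0ℚ ≤ w⁻¹
    0≤w⁻¹ = <⇒≤ (positive⁻¹ w⁻¹ {{1/pos⇒pos w {{positive 0<w}}}})
    open ≡-Reasoning
    square : w⁻¹ * ((f u v - w * Δ) * (f u v - w * Δ)) ≡ f u v * f u v * w⁻¹ - ((f u v * Δ + f u v * Δ) - w * Δ * Δ)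
    square = begin
      w⁻¹ * ((f u v - w * Δ) * (f u v - w * Δ))
        ≡⟨ solve 4 (λ f w D i → i :* ((f :- w :* D) :* (f :- w :* D)) :=
             f :* f :* i :- (w :* i :* ((f :* D :+ f :* D) :- w :* D :* D))) refl (f u v) w Δ w⁻¹ ⟩
      f u v * f u v * w⁻¹ - w * w⁻¹ * ((f u v * Δ + f u v * Δ) - w * Δ * Δ)
        ≡⟨ cong (λ z → f u v * f u v * w⁻¹ - z * ((f u v * Δ + f u v * Δ) - w * Δ * Δ)) (*-inverseʳ w {{>-nonZero 0<w}}) ⟩
      f u v * f u v * w⁻¹ - 1ℚ * ((f u v * Δ + f u v * Δ) - w * Δ * Δ)
        ≡⟨ cong (λ z → f u v * f u v * w⁻¹ - z) (*-identityˡ _) ⟩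
      f u v * f u v * w⁻¹ - ((f u v * Δ + f u v * Δ) - w * Δ * Δ) ∎
  -- Off the edges the flow and the gradient both vanish, matching the value 0 of `pairEnergy`.
  ... | no ≮ = ≤-reflexive (trans (cong₂ (λ p q → (p * Δ + p * Δ) - q * Δ * Δ) (supp u v w≡0) w≡0)
      (solve 1 (λ D → (con 0ℚ :* D :+ con 0ℚ :* D) :- con 0ℚ :* D :* D := con 0ℚ) refl Δ))
    where
    Δ : ℚ
    Δ = ψ u - ψ v
    w≡0 : W G u v ≡ 0ℚ
    w≡0 = ≮⇒W≡0 u v ≮

  pairEnergy-gradient : ∀ φ u v → pairEnergy G (gradient φ) u v ≡ gradient φ u v * (φ u - φ v)
  pairEnergy-gradient φ u v with 0ℚ <? W G u v
  ... | yes 0<w = trans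
    (solve 3 (λ w D i → (w :* D) :* (w :* D) :* i := (w :* i) :* (w :* D :* D)) refl (W G u v) (φ u - φ v) w⁻¹)
    (trans (cong (_* (gradient φ u v * (φ u - φ v))) (*-inverseʳ (W G u v) {{>-nonZero 0<w}})) (*-identityˡ _))
    where
    w⁻¹ : ℚ
    w⁻¹ = (1/ W G u v) {{>-nonZero 0<w}}
  ... | no ≮ = sym (trans (cong (λ z → z * (φ u - φ v) * (φ u - φ v)) (≮⇒W≡0 u v ≮))
      (solve 1 (λ D → con 0ℚ :* D :* D := con 0ℚ) refl (φ u - φ v)))

  -- Weak duality: `pairEnergy-bound` is summed over all pairs, and conservation turns its linear
  -- part into the potential drop. Every test potential thus bounds resistance from below.
  dual-bound : ∀ {s t} (F : UnitFlow G s t) ψ →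
    ((ψ s - ψ t) + (ψ s - ψ t)) - dirichlet ψ ≤ energy F
  dual-bound {s} {t} F ψ = subst (_≤ energy F) total
    (*-monoˡ-≤-nonNeg ½ (ΣQ-mono n (λ u → ΣQ-mono n (pairEnergy-bound (f F) ψ (support F) u))))
    where
    open ≡-Reasoning
    X Y : Fin n → Fin n → ℚ
    X u v = f F u v * (ψ u - ψ v)
    Y u v = gradient ψ u v * (ψ u - ψ v)
    ΣΣ : (Fin n → Fin n → ℚ) → ℚ
    ΣΣ Z = ΣQ n (λ u → ΣQ n (Z u))
    S = ΣQ n (λ u → ψ u * ΣQ n (f F u))
    S≡ : S ≡ ψ s - ψ t
    S≡ = trans (ΣQ-cong n (λ u → cong (ψ u *_) (conserve F u))) (ΣQ-δ-dipole n s t ψ)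
    total : ½ * ΣΣ (λ u v → (X u v + X u v) - Y u v) ≡ ((ψ s - ψ t) + (ψ s - ψ t)) - dirichlet ψ
    total = begin
      ½ * ΣΣ (λ u v → (X u v + X u v) - Y u v)
        ≡⟨ cong (½ *_) (trans (ΣQ-cong n (λ u → trans (ΣQ-sub n _ (Y u)) (cong (λ z → z - ΣQ n (Y u)) (ΣQ-+ n (X u) (X u)))))
             (trans (ΣQ-sub n _ _) (cong (λ z → z - ΣΣ Y) (ΣQ-+ n _ _)))) ⟩
      ½ * ((ΣΣ X + ΣΣ X) - ΣΣ Y)
        ≡⟨ cong₂ (λ x y → ½ * ((x + x) - y)) (sum-by-parts n (f F) ψ (antisym F))
             (sum-by-parts n (gradient ψ) ψ (gradient-anti ψ)) ⟩
      ½ * (((S + S) + (S + S)) - (dirichlet ψ + dirichlet ψ))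
        ≡⟨ solve 2 (λ S T → con ½ :* (((S :+ S) :+ (S :+ S)) :- (T :+ T)) := (S :+ S) :- T) refl S (dirichlet ψ) ⟩
      (S + S) - dirichlet ψ
        ≡⟨ cong (λ z → (z + z) - dirichlet ψ) S≡ ⟩
      ((ψ s - ψ t) + (ψ s - ψ t)) - dirichlet ψ ∎

  module _ {s t : Fin n} (φ : Fin n → ℚ) (φ-lap : ∀ u → lap (W G) φ u ≡ δ s u - δ t u) where

    dirichlet-potential : dirichlet φ ≡ φ s - φ t
    dirichlet-potential = trans (ΣQ-cong n (λ u → cong (φ u *_) (φ-lap u))) (ΣQ-δ-dipole n s t φ)

    potentialFlow : UnitFlow G s t
    potentialFlow = record
      { f        = gradient φ
      ; antisym  = gradient-anti φ
      ; support  = λ u v w≡0 → trans (cong (_* (φ u - φ v)) w≡0) (*-zeroˡ (φ u - φ v))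
      ; conserve = φ-lap
      }

    -- The current of `φ` has energy equal to its drop r, and the dual bound with `φ` itself as test
    -- potential gives 2r - r = r, so this flow is optimal.
    potential⇒effRes : IsEffRes G s t (φ s - φ t)
    potential⇒effRes = (potentialFlow , attained) , minimal
      where
      open ≡-Reasoning
      attained : energy potentialFlow ≡ φ s - φ t
      attained = begin
        energy potentialFlow
          ≡⟨ cong (½ *_) (ΣQ-cong n (λ u → ΣQ-cong n (pairEnergy-gradient φ u))) ⟩
        ½ * ΣQ n (λ u → ΣQ n (λ v → gradient φ u v * (φ u - φ v)))
          ≡⟨ cong (½ *_) (sum-by-parts n (gradient φ) φ (gradient-anti φ)) ⟩
        ½ * (dirichlet φ + dirichlet φ)
          ≡⟨ solve 1 (λ T → con ½ :* (T :+ T) := T) refl (dirichlet φ) ⟩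
        dirichlet φ
          ≡⟨ dirichlet-potential ⟩
        φ s - φ t ∎
      minimal : ∀ F → φ s - φ t ≤ energy F
      minimal F = subst (_≤ energy F)
        (trans (cong (λ z → ((φ s - φ t) + (φ s - φ t)) - z) dirichlet-potential)
          (solve 1 (λ r → (r :+ r) :- r := r) refl (φ s - φ t)))
        (dual-bound F φ)

  degree : Fin n → ℚ
  degree u = ΣQ n (W G u)

  -- The test potential is `a` at `u`, `- a` at `v` and 0 elsewhere. With no edge between `u` and
  -- `v`, each edge at either of them sees a drop of size `a`.
  nonadjacent-energy : ∀ {u v} → u ≢ v → W G u v ≡ 0ℚ → (F : UnitFlow G u v) → ∀ a →
    ((a + a) + (a + a)) - a * a * (degree u + degree v) ≤ energy F
  nonadjacent-energy {u} {v} u≢v w≡0 F a = subst (_≤ energy F)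
    (cong₂ (λ p q → (p + p) - q) drop energy-ψ) (dual-bound F ψ)
    where
    open ≡-Reasoning
    ψ : Fin n → ℚ
    ψ x = a * (δ u x - δ v x)
    ψ-u : ψ u ≡ a
    ψ-u = trans (cong₂ (λ p q → a * (p - q)) (δ-refl u) (δ-≢ u≢v)) (*-identityʳ a)
    ψ-v : ψ v ≡ 0ℚ - a
    ψ-v = trans (cong₂ (λ p q → a * (p - q)) (δ-≢ (u≢v ∘ sym)) (δ-refl v))
      (solve 1 (λ a → a :* (con 0ℚ :- con 1ℚ) := con 0ℚ :- a) refl a)
    drop : ψ u - ψ v ≡ a + a
    drop = trans (cong₂ _-_ ψ-u ψ-v) (solve 1 (λ a → a :- (con 0ℚ :- a) := a :+ a) refl a)
    -- Applied at `u` and `v` only, whose neighbours all have potential 0.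
    lap-ψ : ∀ x → W G x u ≡ 0ℚ → W G x v ≡ 0ℚ → lap (W G) ψ x ≡ degree x * ψ x
    lap-ψ x xu≡0 xv≡0 = begin
      lap (W G) ψ x
        ≡⟨ lap-row n (W G x) ψ (ψ x) ⟩
      degree x * ψ x - ΣQ n (λ y → W G x y * (a * (δ u y - δ v y)))
        ≡⟨ cong (λ z → degree x * ψ x - z) (ΣQ-cong n (λ y → sym (*-assoc (W G x y) a (δ u y - δ v y)))) ⟩
      degree x * ψ x - ΣQ n (λ y → W G x y * a * (δ u y - δ v y))
        ≡⟨ cong (λ z → degree x * ψ x - z) (ΣQ-δ-dipole n u v (λ y → W G x y * a)) ⟩
      degree x * ψ x - (W G x u * a - W G x v * a)
        ≡⟨ cong₂ (λ p q → degree x * ψ x - (p * a - q * a)) xu≡0 xv≡0 ⟩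
      degree x * ψ x - (0ℚ * a - 0ℚ * a)
        ≡⟨ solve 2 (λ z a → z :- (con 0ℚ :* a :- con 0ℚ :* a) := z) refl (degree x * ψ x) a ⟩
      degree x * ψ x ∎
    energy-ψ : dirichlet ψ ≡ a * a * (degree u + degree v)
    energy-ψ = begin
      dirichlet ψ
        ≡⟨ ΣQ-cong n (λ x → solve 3 (λ a d l → a :* d :* l := a :* l :* d) refl a (δ u x - δ v x) (lap (W G) ψ x)) ⟩
      ΣQ n (λ x → a * lap (W G) ψ x * (δ u x - δ v x))
        ≡⟨ ΣQ-δ-dipole n u v (λ x → a * lap (W G) ψ x) ⟩
      a * lap (W G) ψ u - a * lap (W G) ψ v
        ≡⟨ cong₂ (λ p q → a * p - a * q)
             (trans (lap-ψ u (noLoops G u) w≡0) (cong (degree u *_) ψ-u))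
             (trans (lap-ψ v (trans (symm G v u) w≡0) (noLoops G v)) (cong (degree v *_) ψ-v)) ⟩
      a * (degree u * a) - a * (degree v * (0ℚ - a))
        ≡⟨ solve 3 (λ a d e → a :* (d :* a) :- a :* (e :* (con 0ℚ :- a)) := a :* a :* (d :+ e)) refl a (degree u) (degree v) ⟩
      a * a * (degree u + degree v) ∎

-- Complete graph

complete : ∀ n → Graph n
complete n = record
  { W       = λ u v → 1ℚ - δ u v
  ; nonneg  = 0≤1-δ
  ; symm    = λ u v → cong (λ z → 1ℚ - z) (δ-sym u v)
  ; noLoops = λ u → cong (λ z → 1ℚ - z) (δ-refl u)
  }
  where
  0≤1-δ : ∀ u v → 0ℚ ≤ 1ℚ - δ u v
  0≤1-δ u v with v F.≟ u
  ... | yes _ = ≤-refl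
  ... | no _  = nonNegative⁻¹ 1ℚ

module _ {n : ℕ} {i : ℚ} (ni≡1 : ℕ→ℚ n * i ≡ 1ℚ) (s t : Fin n) where

  private
    -- The Laplacian of the complete graph is n times the identity minus the all-ones matrix, which
    -- annihilates dipoles; so a dipole scaled by `i` = 1/n solves the equation.
    φ : Fin n → ℚ
    φ x = i * (δ s x - δ t x)

    Σφ≡0 : ΣQ n (λ y → 1ℚ * φ y) ≡ 0ℚ
    Σφ≡0 = trans (ΣQ-cong n (λ y → sym (*-assoc 1ℚ i (δ s y - δ t y))))
      (trans (ΣQ-δ-dipole n s t (λ _ → 1ℚ * i)) (+-inverseʳ (1ℚ * i)))

    φ-lap : ∀ x → lap (W (complete n)) φ x ≡ δ s x - δ t x
    φ-lap x = begin
      ΣQ n (λ y → (1ℚ - δ x y) * (φ x - φ y))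
        ≡⟨ ΣQ-cong n (λ y → solve 2 (λ d p → (con 1ℚ :- d) :* p := con 1ℚ :* p :- d :* p) refl (δ x y) (φ x - φ y)) ⟩
      ΣQ n (λ y → 1ℚ * (φ x - φ y) - δ x y * (φ x - φ y))
        ≡⟨ ΣQ-sub n _ _ ⟩
      ΣQ n (λ y → 1ℚ * (φ x - φ y)) - ΣQ n (λ y → δ x y * (φ x - φ y))
        ≡⟨ cong₂ _-_ (lap-row n (λ _ → 1ℚ) φ (φ x)) (ΣQ-δ n x (λ y → φ x - φ y)) ⟩
      (ΣQ n (λ _ → 1ℚ) * φ x - ΣQ n (λ y → 1ℚ * φ y)) - (φ x - φ x)
        ≡⟨ cong₂ (λ p q → (p * φ x - q) - (φ x - φ x)) (ΣQ-1 n) Σφ≡0 ⟩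
      (ℕ→ℚ n * φ x - 0ℚ) - (φ x - φ x)
        ≡⟨ solve 3 (λ n i d → (n :* (i :* d) :- con 0ℚ) :- (i :* d :- i :* d) := n :* i :* d) refl (ℕ→ℚ n) i (δ s x - δ t x) ⟩
      ℕ→ℚ n * i * (δ s x - δ t x)
        ≡⟨ trans (cong (_* (δ s x - δ t x)) ni≡1) (*-identityˡ _) ⟩
      δ s x - δ t x ∎
      where open ≡-Reasoning

  complete-flow : UnitFlow (complete n) s t
  complete-flow = potentialFlow (complete n) φ φ-lap

  complete-effRes : s ≢ t → IsEffRes (complete n) s t (i + i)
  complete-effRes s≢t = subst (IsEffRes (complete n) s t) drop (potential⇒effRes (complete n) φ φ-lap)
    where
    drop : φ s - φ t ≡ i + i
    drop = trans
      (cong₂ (λ p q → i * p - i * q) (cong₂ _-_ (δ-refl s) (δ-≢ s≢t)) (cong₂ _-_ (δ-≢ (s≢t ∘ sym)) (δ-refl t)))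
      (solve 1 (λ i → i :* (con 1ℚ :- con 0ℚ) :- i :* (con 0ℚ :- con 1ℚ) := i :+ i) refl i)

-- The entry (LRL)ᵤᵤ = -2 Lᵤᵤ of the identity LRL = -2L between Laplacian and resistance matrix,
-- with φ x the potential of the unit flow from x to u.
star-identity : ∀ n (w : Fin n → ℚ) (φ : Fin n → Fin n → ℚ) u → w u ≡ 0ℚ →
  (∀ x → ΣQ n (λ y → w y * (φ x u - φ x y)) ≡ δ x u - δ u u) →
  let d = ΣQ n w
      R = λ x y → (φ x x - φ y x) - (φ x y - φ y y)
      X = ΣQ n (λ x → w x * R u x)
  in (d * X + d * X) - ΣQ n (λ x → w x * ΣQ n (λ y → w y * R x y)) ≡ d + d
star-identity n w φ u wu≡0 φ-lap = begin
  (d * X + d * X) - Z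
    ≡⟨ cong₂ (λ x z → (d * x + d * x) - z) X≡ Z≡ ⟩
  (d * ((d * φ u u - B) - (Q' u - A)) + d * ((d * φ u u - B) - (Q' u - A))) - ((d * A - ΣwQ) - (ΣwQ - d * A))
    ≡⟨ cong₂ (λ q z → (d * ((d * φ u u - B) - (q - A)) + d * ((d * φ u u - B) - (q - A))) - ((d * A - z) - (z - d * A)))
         (Q'≡ u) ΣwQ≡ ⟩
  (d * ((d * φ u u - B) - ((d * φ u u - (δ u u - δ u u)) - A)) + d * ((d * φ u u - B) - ((d * φ u u - (δ u u - δ u u)) - A)))
    - ((d * A - (d * B - (0ℚ - d))) - ((d * B - (0ℚ - d)) - d * A))
    -- `φ u u`, `A` and `B` depend on the additive constants of the potentials; they cancel.
    ≡⟨ solve 5 (λ d p e A B → let x = d :* ((d :* p :- B) :- ((d :* p :- (e :- e)) :- A))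
                                  z = d :* B :- (con 0ℚ :- d)
                              in (x :+ x) :- ((d :* A :- z) :- (z :- d :* A)) := d :+ d) refl d (φ u u) (δ u u) A B ⟩
  d + d ∎
  where
  open ≡-Reasoning
  d A B ΣwQ X Z : ℚ
  R : Fin n → Fin n → ℚ
  Q' : Fin n → ℚ
  d = ΣQ n w
  R x y = (φ x x - φ y x) - (φ x y - φ y y)
  X = ΣQ n (λ x → w x * R u x)
  Z = ΣQ n (λ x → w x * ΣQ n (λ y → w y * R x y))
  A = ΣQ n (λ x → w x * φ x x)
  B = ΣQ n (λ x → w x * φ x u)
  Q' x = ΣQ n (λ y → w y * φ x y)
  ΣwQ = ΣQ n (λ x → w x * Q' x)

  row : ∀ p (f g h : Fin n → ℚ) → ΣQ n (λ y → w y * ((p - f y) - (g y - h y))) ≡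
    (d * p - ΣQ n (λ y → w y * f y)) - (ΣQ n (λ y → w y * g y) - ΣQ n (λ y → w y * h y))
  row p f g h = begin
    ΣQ n (λ y → w y * ((p - f y) - (g y - h y)))
      ≡⟨ ΣQ-cong n (λ y → solve 5 (λ w p f g h → w :* ((p :- f) :- (g :- h)) := w :* (p :- f) :- (w :* g :- w :* h))
           refl (w y) p (f y) (g y) (h y)) ⟩
    ΣQ n (λ y → w y * (p - f y) - (w y * g y - w y * h y))
      ≡⟨ trans (ΣQ-sub n _ _) (cong₂ _-_ (lap-row n w f p) (ΣQ-sub n _ _)) ⟩
    _ ∎

  X≡ : X ≡ (d * φ u u - B) - (Q' u - A)
  X≡ = row (φ u u) (λ x → φ x u) (φ u) (λ x → φ x x)

  -- The equation of the potential `φ x` at the vertex `u`, solved for the sum over neighbours.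
  Q'≡ : ∀ x → Q' x ≡ d * φ x u - (δ x u - δ u u)
  Q'≡ x = begin
    Q' x                                    ≡⟨ solve 2 (λ q z → q := z :- (z :- q)) refl (Q' x) (d * φ x u) ⟩
    d * φ x u - (d * φ x u - Q' x)          ≡⟨ cong (λ z → d * φ x u - z) (lap-row n w (φ x) (φ x u)) ⟨
    d * φ x u - ΣQ n (λ y → w y * (φ x u - φ x y)) ≡⟨ cong (λ z → d * φ x u - z) (φ-lap x) ⟩
    d * φ x u - (δ x u - δ u u)             ∎

  ΣwQ≡ : ΣwQ ≡ d * B - (0ℚ - d)
  ΣwQ≡ = begin
    ΣwQ
      ≡⟨ ΣQ-cong n (λ x → trans (cong (w x *_) (trans (Q'≡ x) (cong₂ (λ p q → d * φ x u - (p - q)) (δ-sym x u) (δ-refl u))))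
           (solve 4 (λ w d p e → w :* (d :* p :- (e :- con 1ℚ)) := d :* (w :* p) :- (e :* w :- w)) refl (w x) d (φ x u) (δ u x))) ⟩
    ΣQ n (λ x → d * (w x * φ x u) - (δ u x * w x - w x))
      ≡⟨ trans (ΣQ-sub n _ _) (cong₂ _-_ (ΣQ-*ˡ n d _) (ΣQ-sub n _ _)) ⟩
    d * B - (ΣQ n (λ x → δ u x * w x) - d)
      -- The delta picks out `w u`, which is 0; the remaining `d` is the source of the right-hand
      -- side `d + d`.
      ≡⟨ cong (λ z → d * B - (z - d)) (trans (ΣQ-δ n u w) wu≡0) ⟩
    d * B - (0ℚ - d) ∎

  transposed : ΣQ n (λ x → w x * ΣQ n (λ y → w y * φ y x)) ≡ ΣwQ
  transposed = begin
    ΣQ n (λ x → w x * ΣQ n (λ y → w y * φ y x))   ≡⟨ ΣQ-cong n (λ x → ΣQ-*ˡ n (w x) _) ⟨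
    ΣQ n (λ x → ΣQ n (λ y → w x * (w y * φ y x))) ≡⟨ ΣQ-swap n n _ ⟩
    ΣQ n (λ y → ΣQ n (λ x → w x * (w y * φ y x)))
      ≡⟨ ΣQ-cong n (λ y → trans
           (ΣQ-cong n (λ x → solve 3 (λ a b p → a :* (b :* p) := b :* (a :* p)) refl (w x) (w y) (φ y x)))
           (ΣQ-*ˡ n (w y) _)) ⟩
    ΣwQ ∎

  Z≡ : Z ≡ (d * A - ΣwQ) - (ΣwQ - d * A)
  Z≡ = begin
    Z
      ≡⟨ ΣQ-cong n (λ x → cong (w x *_) (row (φ x x) (λ y → φ y x) (φ x) (λ y → φ y y))) ⟩
    ΣQ n (λ x → w x * ((d * φ x x - ΣQ n (λ y → w y * φ y x)) - (Q' x - A)))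
      ≡⟨ ΣQ-cong n (λ x → solve 6 (λ w d p t q A → w :* ((d :* p :- t) :- (q :- A)) :=
           (d :* (w :* p) :- w :* t) :- (w :* q :- w :* A)) refl (w x) d (φ x x) _ (Q' x) A) ⟩
    ΣQ n (λ x → (d * (w x * φ x x) - w x * ΣQ n (λ y → w y * φ y x)) - (w x * Q' x - w x * A))
      ≡⟨ trans (ΣQ-sub n _ _) (cong₂ _-_ (ΣQ-sub n _ _) (ΣQ-sub n _ _)) ⟩
    (ΣQ n (λ x → d * (w x * φ x x)) - ΣQ n (λ x → w x * ΣQ n (λ y → w y * φ y x))) - (ΣwQ - ΣQ n (λ x → w x * A))
      ≡⟨ cong₂ (λ p q → p - (ΣwQ - q)) (cong₂ _-_ (ΣQ-*ˡ n d _) transposed) (ΣQ-*ʳ n A w) ⟩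
    (d * A - ΣwQ) - (ΣwQ - d * A) ∎

-- Adjacency

-- Valued in ℕ so as to be comparable with `edgeIndicator`.
adjacent : ∀ {n} → Graph n → Fin n → Fin n → ℕ
adjacent G u v with 0ℚ <? W G u v
... | yes _ = 1
... | no _  = 0

adj : ∀ {n} → Graph n → Fin n → Fin n → ℚ
adj G u v = ℕ→ℚ (adjacent G u v)

module _ {n : ℕ} (G : Graph n) where

  neighbours : Fin n → ℚ
  neighbours u = ΣQ n (adj G u)

  adjacent-cases : ∀ u v → (0ℚ < W G u v × adjacent G u v ≡ 1) ⊎ (W G u v ≡ 0ℚ × adjacent G u v ≡ 0)
  adjacent-cases u v with 0ℚ <? W G u v
  ... | yes 0<w = inj₁ (0<w , refl)
  ... | no ≮    = inj₂ (≮⇒W≡0 G u v ≮ , refl)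

  0≤adj : ∀ u v → 0ℚ ≤ adj G u v
  0≤adj u v = 0≤ℕ→ℚ (adjacent G u v)

  adj-idem : ∀ u v → adj G u v * adj G u v ≡ adj G u v
  adj-idem u v = [ (λ (_ , a≡1) → trans (cong (_* adj G u v) (cong ℕ→ℚ a≡1)) (*-identityˡ (adj G u v)))
                 , (λ (_ , a≡0) → trans (cong (_* adj G u v) (cong ℕ→ℚ a≡0))
                     (trans (*-zeroˡ (adj G u v)) (cong ℕ→ℚ (sym a≡0)))) ]′ (adjacent-cases u v)

  W*adj : ∀ u v → W G u v * adj G u v ≡ W G u v
  W*adj u v = [ (λ (_ , a≡1) → trans (cong (W G u v *_) (cong ℕ→ℚ a≡1)) (*-identityʳ (W G u v)))
              , (λ (w≡0 , _) → trans (cong (_* adj G u v) w≡0) (trans (*-zeroˡ (adj G u v)) (sym w≡0))) ]′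
              (adjacent-cases u v)

  -- Only the increasing orientation of an edge is counted, so at most one summand is 1; equal
  -- endpoints are excluded by the absence of loops.
  edgeIndicator-symm : ∀ u v → edgeIndicator G u v ℕ.+ edgeIndicator G v u ≡ adjacent G u v
  edgeIndicator-symm u v with toℕ u ℕ.<? toℕ v | toℕ v ℕ.<? toℕ u | 0ℚ <? W G u v | 0ℚ <? W G v u
  ... | yes u<v | yes v<u | _ | _ = contradiction v<u (ℕ.<-asym u<v)
  ... | yes _ | no _ | yes _ | _ = refl
  ... | yes _ | no _ | no _ | _ = refl
  ... | no _ | yes _ | yes _ | yes _ = refl
  ... | no _ | yes _ | yes 0<w | no ≮ = contradiction (subst (0ℚ <_) (symm G u v) 0<w) ≮
  ... | no _ | yes _ | no ≮ | yes 0<w = contradiction (subst (0ℚ <_) (symm G v u) 0<w) ≮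
  ... | no _ | yes _ | no _ | no _ = refl
  ... | no _ | no _ | no _ | _ = refl
  ... | no u≮v | no v≮u | yes 0<w | _ = contradiction
    (subst (λ z → 0ℚ < W G u z) (toℕ-injective (ℕ.≤-antisym (ℕ.≮⇒≥ u≮v) (ℕ.≮⇒≥ v≮u))) 0<w)
    (<-irrefl (sym (noLoops G u)))

  handshake : ΣQ n neighbours ≡ ℕ→ℚ (numEdges G) + ℕ→ℚ (numEdges G)
  handshake = begin
    ΣQ n neighbours
      ≡⟨ ΣQ-cong n (λ u → trans
           (ΣQ-cong n (λ v → trans (cong ℕ→ℚ (sym (edgeIndicator-symm u v))) (ℕ→ℚ-+ (edgeIndicator G u v) (edgeIndicator G v u))))
           (ΣQ-+ n _ _)) ⟩
    ΣQ n (λ u → ΣQ n (e u) + ΣQ n (λ v → e v u))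
      ≡⟨ trans (ΣQ-+ n _ _) (cong (ΣQ n (λ u → ΣQ n (e u)) +_) (ΣQ-swap n n (λ u v → e v u))) ⟩
    ΣQ n (λ u → ΣQ n (e u)) + ΣQ n (λ u → ΣQ n (e u))
      ≡⟨ cong (λ z → z + z) (trans (ΣQ-cong n (λ u → ΣQ-Σℕ n (edgeIndicator G u))) (ΣQ-Σℕ n _)) ⟩
    ℕ→ℚ (numEdges G) + ℕ→ℚ (numEdges G) ∎
    where
    open ≡-Reasoning
    e : Fin n → Fin n → ℚ
    e u v = ℕ→ℚ (edgeIndicator G u v)

  weight² : Fin n → ℚ
  weight² u = ΣQ n (λ v → W G u v * W G u v)

  -- Expansion of Σ (w - t)² over the neighbours of u.
  weight²-bound : ∀ u t → (t * degree G u + t * degree G u) - t * t * neighbours u ≤ weight² u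
  weight²-bound u t = 0≤q-p⇒p≤q (subst (0ℚ ≤_) expand (ΣQ-nonneg n (λ v → 0≤p² (w v - t * a v))))
    where
    open ≡-Reasoning
    w a : Fin n → ℚ
    w = W G u
    a = adj G u
    expand : ΣQ n (λ v → (w v - t * a v) * (w v - t * a v)) ≡
      weight² u - ((t * degree G u + t * degree G u) - t * t * neighbours u)
    expand = begin
      ΣQ n (λ v → (w v - t * a v) * (w v - t * a v))
        ≡⟨ ΣQ-cong n (λ v → trans
             (solve 3 (λ w t a → (w :- t :* a) :* (w :- t :* a) :=
                w :* w :- ((t :* (w :* a) :+ t :* (w :* a)) :- t :* t :* (a :* a))) refl (w v) t (a v))
             (cong₂ (λ p q → w v * w v - ((t * p + t * p) - t * t * q)) (W*adj u v) (adj-idem u v))) ⟩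
      ΣQ n (λ v → w v * w v - ((t * w v + t * w v) - t * t * a v))
        ≡⟨ trans (ΣQ-sub n _ _) (cong (λ z → weight² u - z) (trans (ΣQ-sub n _ _) (cong₂ _-_
             (trans (ΣQ-+ n _ _) (cong₂ _+_ (ΣQ-*ˡ n t w) (ΣQ-*ˡ n t w))) (ΣQ-*ˡ n (t * t) a)))) ⟩
      weight² u - ((t * degree G u + t * degree G u) - t * t * neighbours u) ∎

-- Sparsifiers of the complete graph

module Sparsifier {n : ℕ} {i ε : ℚ} (0<n : 0ℚ < ℕ→ℚ n) (0<i : 0ℚ < i) (ni≡1 : ℕ→ℚ n * i ≡ 1ℚ) (0<ε : 0ℚ < ε)
  (H : Graph n) (H-sparsifies : IsResistanceSparsifier ε (complete n) H) where

  -- Finiteness of resistances carries over from the complete graph: `H` is connected.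
  flow : ∀ x y → UnitFlow H x y
  flow x y = Equivalence.to (proj₁ (H-sparsifies x y)) (complete-flow ni≡1 x y)

  -- Here `i` is 1/n, and `i + i` is the resistance between distinct vertices of the complete graph.
  effRes-bounds : ∀ {x y r} → x ≢ y → IsEffRes H x y r →
    ((1ℚ - ε) * (i + i) ≤ r) × (r ≤ (1ℚ + ε) * (i + i))
  effRes-bounds {x} {y} x≢y = proj₂ (H-sparsifies x y) _ _ (complete-effRes ni≡1 x y x≢y)

  4ε : ℚ
  4ε = (ε + ε) + (ε + ε)

  0<1+ε : 0ℚ < 1ℚ + ε
  0<1+ε = +-mono-< (positive⁻¹ 1ℚ) 0<ε

  0<4ε : 0ℚ < 4ε
  0<4ε = +-mono-< (+-mono-< 0<ε 0<ε) (+-mono-< 0<ε 0<ε)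

  -- The flow shows that the Laplacian system with dipole right-hand side is consistent, which is
  -- what `potential` asks for.
  flow-potential : ∀ x y → Σ (Fin n → ℚ) λ φ → ∀ z → lap (W H) φ z ≡ δ x z - δ y z
  flow-potential x y = proj₁ solution , λ z → trans (proj₂ solution z) (conserve F z)
    where
    F : UnitFlow H x y
    F = flow x y
    solution = potential n (W H) (f F) (nonneg H) (symm H) (antisym F) (support F)

  module Star (u : Fin n) (φ : Fin n → Fin n → ℚ) (φ-lap : ∀ x z → lap (W H) (φ x) z ≡ δ x z - δ u z) where

    -- All potentials `φ x` share the sink `u`, so by superposition `φ x - φ y` belongs to a unit
    -- flow from `x` to `y`; `R x y` is its drop.
    R : Fin n → Fin n → ℚ
    R x y = (φ x x - φ y x) - (φ x y - φ y y)

    R-refl : ∀ x → R x x ≡ 0ℚ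
    R-refl x = +-inverseʳ (φ x x - φ x x)

    R-effRes : ∀ x y → IsEffRes H x y (R x y)
    R-effRes x y = potential⇒effRes H (λ z → φ x z - φ y z) (λ z → begin
      lap (W H) (λ z → φ x z - φ y z) z         ≡⟨ lap-sub (W H) (φ x) (φ y) z ⟩
      lap (W H) (φ x) z - lap (W H) (φ y) z     ≡⟨ cong₂ _-_ (φ-lap x z) (φ-lap y z) ⟩
      (δ x z - δ u z) - (δ y z - δ u z)
        ≡⟨ solve 3 (λ x u y → (x :- u) :- (y :- u) := x :- y) refl (δ x z) (δ u z) (δ y z) ⟩
      δ x z - δ y z ∎)
      where open ≡-Reasoning

    w : Fin n → ℚ
    w = W H u
    d S N lo hi X Z : ℚ
    d = degree H u
    S = weight² H u
    N = neighbours H u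
    lo = (1ℚ - ε) * (i + i)
    hi = (1ℚ + ε) * (i + i)
    X = ΣQ n (λ x → w x * R u x)
    Z = ΣQ n (λ x → w x * ΣQ n (λ y → w y * R x y))

    0≤w : ∀ x → 0ℚ ≤ w x
    0≤w = nonneg H u

    identity : (d * X + d * X) - Z ≡ d + d
    identity = star-identity n w φ u (noLoops H u) (λ x → φ-lap x u)

    X-bound : d * lo ≤ X
    X-bound = subst (_≤ X) (ΣQ-*ʳ n lo w) (ΣQ-mono n term)
      where
      term : ∀ x → w x * lo ≤ w x * R u x
      term x with u F.≟ x
      -- The resistance of `u` to itself is 0 and need not reach `lo`, but its weight is 0.
      ... | yes refl = ≤-reflexive (trans (cong (_* lo) (noLoops H u))
                         (trans (*-zeroˡ lo) (sym (trans (cong (_* R u u) (noLoops H u)) (*-zeroˡ (R u u))))))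
      ... | no u≢x = *-monoˡ-≤-nonNeg (w x) {{nonNegative (0≤w x)}} (proj₁ (effRes-bounds u≢x (R-effRes u x)))

    -- Diagonal pairs contribute nothing since `R x x` is 0; the weights of the others sum to
    -- `d * d - S`. This is how `S` enters.
    Z-bound : Z ≤ hi * (d * d - S)
    Z-bound = ≤-trans
      (ΣQ-mono n (λ x → *-monoˡ-≤-nonNeg (w x) {{nonNegative (0≤w x)}} (row x)))
      (≤-reflexive collect)
      where
      open ≡-Reasoning
      term : ∀ x y → w y * R x y ≤ hi * (w y - δ x y * w y)
      term x y with y F.≟ x
      ... | yes refl = ≤-reflexive (trans (cong (w y *_) (R-refl y))
                         (solve 2 (λ w h → w :* con 0ℚ := h :* (w :- con 1ℚ :* w)) refl (w y) hi))
      ... | no y≢x = ≤-trans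
        (*-monoˡ-≤-nonNeg (w y) {{nonNegative (0≤w y)}} (proj₂ (effRes-bounds (y≢x ∘ sym) (R-effRes x y))))
        (≤-reflexive (solve 2 (λ w h → w :* h := h :* (w :- con 0ℚ :* w)) refl (w y) hi))
      row : ∀ x → ΣQ n (λ y → w y * R x y) ≤ hi * (d - w x)
      row x = ≤-trans (ΣQ-mono n (term x)) (≤-reflexive (trans (ΣQ-*ˡ n hi _)
        (cong (hi *_) (trans (ΣQ-sub n _ _) (cong (λ z → d - z) (ΣQ-δ n x w))))))
      collect : ΣQ n (λ x → w x * (hi * (d - w x))) ≡ hi * (d * d - S)
      collect = begin
        ΣQ n (λ x → w x * (hi * (d - w x)))
          ≡⟨ ΣQ-cong n (λ x → solve 3 (λ w h d → w :* (h :* (d :- w)) := h :* (d :* w :- w :* w)) refl (w x) hi d) ⟩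
        ΣQ n (λ x → hi * (d * w x - w x * w x))
          ≡⟨ trans (ΣQ-*ˡ n hi _) (cong (hi *_) (trans (ΣQ-sub n _ _) (cong (λ z → z - S) (ΣQ-*ˡ n d w)))) ⟩
        hi * (d * d - S) ∎

    -- The identity and both bounds, scaled by n/2, give nd ≥ (1 - 3ε)d² + (1 + ε)S; the hypothesis
    -- replaces nd by the larger (1 + ε)d².
    weight²-upper : ℕ→ℚ n ≤ (1ℚ + ε) * d → 0ℚ ≤ 4ε * (d * d) - (1ℚ + ε) * S
    weight²-upper n≤d = subst (0ℚ ≤_) combine
      (0≤-* {½} (nonNegative⁻¹ ½) (0≤-+ (0≤-* (<⇒≤ 0<n) 0≤Y₁) (0≤-+ 0≤Y₂ 0≤Y₂)))
      where
      open ≡-Reasoning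
      m Y₁ Y₂ : ℚ
      m = ℕ→ℚ n
      -- `Y₁` collects the slacks of the bounds on `X` and `Z`, and `Y₂` is `d` times the slack of
      -- the hypothesis.
      Y₁ = (d * (X - d * lo) + d * (X - d * lo)) + (hi * (d * d - S) - Z)
      Y₂ = d * ((1ℚ + ε) * d - m)
      0≤d : 0ℚ ≤ d
      0≤d = ΣQ-nonneg n 0≤w
      0≤Y₁ : 0ℚ ≤ Y₁
      0≤Y₁ = 0≤-+ (0≤-+ 0≤dX 0≤dX) (p≤q⇒0≤q-p Z-bound)
        where
        0≤dX : 0ℚ ≤ d * (X - d * lo)
        0≤dX = 0≤-* 0≤d (p≤q⇒0≤q-p X-bound)
      0≤Y₂ : 0ℚ ≤ Y₂
      0≤Y₂ = 0≤-* 0≤d (p≤q⇒0≤q-p n≤d)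
      Y₁≡ : Y₁ ≡ (d + d) + (hi * (d * d - S) - (d * d * lo + d * d * lo))
      Y₁≡ = begin
        Y₁
          ≡⟨ solve 6 (λ d X Z S lo hi → (d :* (X :- d :* lo) :+ d :* (X :- d :* lo)) :+ (hi :* (d :* d :- S) :- Z)
               := ((d :* X :+ d :* X) :- Z) :+ (hi :* (d :* d :- S) :- (d :* d :* lo :+ d :* d :* lo)))
               refl d X Z S lo hi ⟩
        ((d * X + d * X) - Z) + (hi * (d * d - S) - (d * d * lo + d * d * lo))
          ≡⟨ cong (_+ (hi * (d * d - S) - (d * d * lo + d * d * lo))) identity ⟩
        (d + d) + (hi * (d * d - S) - (d * d * lo + d * d * lo)) ∎
      combine : ½ * (m * Y₁ + (Y₂ + Y₂)) ≡ 4ε * (d * d) - (1ℚ + ε) * S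
      combine = begin
        ½ * (m * Y₁ + (Y₂ + Y₂))
          ≡⟨ cong (λ z → ½ * (m * z + (Y₂ + Y₂))) Y₁≡ ⟩
        ½ * (m * ((d + d) + (hi * (d * d - S) - (d * d * lo + d * d * lo))) + (Y₂ + Y₂))
          ≡⟨ solve 5 (λ m i e d S →
               let lo = (con 1ℚ :- e) :* (i :+ i)
                   hi = (con 1ℚ :+ e) :* (i :+ i)
                   y = d :* ((con 1ℚ :+ e) :* d :- m)
               in con ½ :* (m :* ((d :+ d) :+ (hi :* (d :* d :- S) :- (d :* d :* lo :+ d :* d :* lo))) :+ (y :+ y))
                  := (m :* i) :* ((con 1ℚ :+ e) :* (d :* d :- S) :- (d :* d :* (con 1ℚ :- e) :+ d :* d :* (con 1ℚ :- e)))
                     :+ (con 1ℚ :+ e) :* (d :* d)) refl m i ε d S ⟩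
        (m * i) * ((1ℚ + ε) * (d * d - S) - (d * d * (1ℚ - ε) + d * d * (1ℚ - ε))) + (1ℚ + ε) * (d * d)
          ≡⟨ cong (λ z → z * ((1ℚ + ε) * (d * d - S) - (d * d * (1ℚ - ε) + d * d * (1ℚ - ε))) + (1ℚ + ε) * (d * d)) ni≡1 ⟩
        1ℚ * ((1ℚ + ε) * (d * d - S) - (d * d * (1ℚ - ε) + d * d * (1ℚ - ε))) + (1ℚ + ε) * (d * d)
          ≡⟨ solve 3 (λ e d S → con 1ℚ :* ((con 1ℚ :+ e) :* (d :* d :- S) :- (d :* d :* (con 1ℚ :- e) :+ d :* d :* (con 1ℚ :- e)))
               :+ (con 1ℚ :+ e) :* (d :* d) := ((e :+ e) :+ (e :+ e)) :* (d :* d) :- (con 1ℚ :+ e) :* S) refl ε d S ⟩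
        4ε * (d * d) - (1ℚ + ε) * S ∎

    -- S ≥ 2td - t²N at t = 4εd, a division-free substitute for t = d/N.
    degree⇒neighbours : ℕ→ℚ n ≤ (1ℚ + ε) * d → 1ℚ ≤ 4ε * N
    -- If 4εN < 1, a positive term and two nonnegative slacks would add up to zero.
    degree⇒neighbours n≤d = ≮⇒≥ λ few → <⇒≢
      (+-mono-<-≤ {0ℚ} (0<-* (0<-* 0<4ε (0<-* 0<d 0<d)) (p<q⇒0<q-p few))
        (0≤-+ (p≤q⇒0≤q-p (weight²-bound H u (4ε * d))) (0≤-+ 0≤εS (weight²-upper n≤d))))
      (sym (solve 4 (λ e d N S → let k = (e :+ e) :+ (e :+ e)
                                     t = k :* d in
          k :* (d :* d) :* (con 1ℚ :- k :* N) :+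
            ((S :- ((t :* d :+ t :* d) :- t :* t :* N)) :+ (e :* S :+ (k :* (d :* d) :- (con 1ℚ :+ e) :* S)))
          := con 0ℚ) refl ε d N S))
      where
      0<d : 0ℚ < d
      0<d = *-cancelˡ-<-nonNeg (1ℚ + ε) {{nonNegative (<⇒≤ 0<1+ε)}}
        (subst (_< (1ℚ + ε) * d) (sym (*-zeroʳ (1ℚ + ε))) (<-≤-trans 0<n n≤d))
      0≤εS : 0ℚ ≤ ε * S
      0≤εS = 0≤-* (<⇒≤ 0<ε) (ΣQ-nonneg n (λ x → 0≤p² (w x)))

  many-neighbours : ∀ u → ℕ→ℚ n ≤ (1ℚ + ε) * degree H u → 1ℚ ≤ 4ε * neighbours H u
  many-neighbours u = Star.degree⇒neighbours u (λ x → proj₁ (flow-potential x u)) (λ x → proj₂ (flow-potential x u))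

  effRes : ∀ x y → Σ ℚ (IsEffRes H x y)
  effRes x y = _ , potential⇒effRes H (proj₁ (flow-potential x y)) (proj₂ (flow-potential x y))

  -- The dipole bound gives 4a - a²(du + dv) ≤ 2a, hence 2a ≤ 2a² du, and division by 2a leaves 1 ≤
  -- a du.
  larger-degree : ∀ {u v} → u ≢ v → W H u v ≡ 0ℚ → degree H v ≤ degree H u → ℕ→ℚ n ≤ (1ℚ + ε) * degree H u
  larger-degree {u} {v} u≢v w≡0 dv≤du = *-cancelʳ-≤-pos i {{positive 0<i}}
    (subst₂ _≤_ (sym ni≡1) (solve 3 (λ e i d → (con 1ℚ :+ e) :* i :* d := (con 1ℚ :+ e) :* d :* i) refl ε i du)
      (*-cancelˡ-≤-pos a {{positive 0<a}} (0≤q-p⇒p≤q (subst (0ℚ ≤_) combine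
        (0≤-* {½} (nonNegative⁻¹ ½) (0≤-+ (p≤q⇒0≤q-p energy-lower) (0≤-+ (p≤q⇒0≤q-p energy-upper)
          (0≤-* (0≤p² a) (p≤q⇒0≤q-p dv≤du)))))))))
    where
    a du dv : ℚ
    -- Half the upper bound on the resistance: the maximiser of 4a - a²D is half of its maximum.
    a = (1ℚ + ε) * i
    du = degree H u
    dv = degree H v
    0<a : 0ℚ < a
    0<a = 0<-* 0<1+ε 0<i
    uv-effRes : IsEffRes H u v (proj₁ (effRes u v))
    uv-effRes = proj₂ (effRes u v)
    F : UnitFlow H u v
    F = proj₁ (proj₁ uv-effRes)
    energy-upper : energy F ≤ (1ℚ + ε) * (i + i)
    energy-upper = subst (_≤ (1ℚ + ε) * (i + i)) (sym (proj₂ (proj₁ uv-effRes)))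
      (proj₂ (effRes-bounds u≢v uv-effRes))
    energy-lower : ((a + a) + (a + a)) - a * a * (du + dv) ≤ energy F
    energy-lower = nonadjacent-energy H u≢v w≡0 F a
    combine : ½ * ((energy F - (((a + a) + (a + a)) - a * a * (du + dv))) +
        (((1ℚ + ε) * (i + i) - energy F) + a * a * (du - dv))) ≡ a * (a * du) - a * 1ℚ
    combine = solve 5 (λ e i d d' E → let a = (con 1ℚ :+ e) :* i in
      con ½ :* ((E :- (((a :+ a) :+ (a :+ a)) :- a :* a :* (d :+ d'))) :+
        (((con 1ℚ :+ e) :* (i :+ i) :- E) :+ a :* a :* (d :- d'))) := a :* (a :* d) :- a :* con 1ℚ)
      refl ε i du dv (energy F)

  nonadjacent⇒many-neighbours : ∀ {u v} → u ≢ v → W H u v ≡ 0ℚ →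
    (1ℚ ≤ 4ε * neighbours H u) ⊎ (1ℚ ≤ 4ε * neighbours H v)
  nonadjacent⇒many-neighbours {u} {v} u≢v w≡0 =
    [ (λ dv≤du → inj₁ (many-neighbours u (larger-degree u≢v w≡0 dv≤du)))
    , (λ du≤dv → inj₂ (many-neighbours v (larger-degree (u≢v ∘ sym) (trans (symm H v u) w≡0) du≤dv)))
    ]′ (≤-total (degree H v) (degree H u))

  -- From an isolated vertex no unit of flow can leave.
  has-neighbour : ∀ {u t} → t ≢ u → 1ℚ ≤ neighbours H u
  has-neighbour {u} {t} t≢u = by-cases (any? (λ v → 0ℚ <? W H u v))
    where
    by-cases : Dec (Σ (Fin n) λ v → 0ℚ < W H u v) → 1ℚ ≤ neighbours H u
    by-cases (yes (v , 0<w)) = [ (λ (_ , a≡1) → subst (_≤ neighbours H u) (cong ℕ→ℚ a≡1) (ΣQ-term≤ n (0≤adj H u) v))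
                               , (λ (w≡0 , _) → contradiction (sym w≡0) (<⇒≢ 0<w)) ]′ (adjacent-cases H u v)
    by-cases (no isolated) = contradiction
      (begin
        1ℚ                          ≡⟨ cong₂ _-_ (δ-refl u) (δ-≢ (t≢u ∘ sym)) ⟨
        δ u u - δ t u               ≡⟨ conserve (flow u t) u ⟨
        ΣQ n (f (flow u t) u)       ≡⟨ ΣQ-zero n (λ v → support (flow u t) u v (≮⇒W≡0 H u v (λ 0<w → isolated (v , 0<w)))) ⟩
        0ℚ                          ∎)
      1≢0
      where open ≡-Reasoning

  -- A vertex u with few neighbours forces all its non-neighbours to have many, and there are
  -- at least n - 1 - n/4 of those.
  edge-count : ℕ→ℚ 2 ≤ ℕ→ℚ n → 1ℚ < ε * ℕ→ℚ n →
    let K = 4ε * ΣQ n (neighbours H) in ℕ→ℚ n ≤ (K + K) + (K + K)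
  edge-count 2≤n 1<εn = by-cases (any? (λ u → 4ε * neighbours H u <? 1ℚ))
    where
    K : ℚ
    K = 4ε * ΣQ n (neighbours H)
    0≤4εN : ∀ v → 0ℚ ≤ 4ε * neighbours H v
    0≤4εN v = 0≤-* (<⇒≤ 0<4ε) (ΣQ-nonneg n (0≤adj H v))
    0≤K : 0ℚ ≤ K
    0≤K = 0≤-* (<⇒≤ 0<4ε) (ΣQ-nonneg n (λ v → ΣQ-nonneg n (0≤adj H v)))
    by-cases : Dec (Σ (Fin n) λ u → 4ε * neighbours H u < 1ℚ) → ℕ→ℚ n ≤ (K + K) + (K + K)
    by-cases (no none-few) = ≤-trans n≤K (0≤q-p⇒p≤q (subst (0ℚ ≤_)
      (solve 1 (λ K → K :+ (K :+ K) := ((K :+ K) :+ (K :+ K)) :- K) refl K) (0≤-+ 0≤K (0≤-+ 0≤K 0≤K))))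
      where
      n≤K : ℕ→ℚ n ≤ K
      n≤K = subst₂ _≤_ (ΣQ-1 n) (ΣQ-*ˡ n 4ε (neighbours H))
        (ΣQ-mono n (λ u → ≮⇒≥ (λ few → none-few (u , few))))
    by-cases (yes (u , few)) = 0≤q-p⇒p≤q (subst (0ℚ ≤_)
      -- From K ≥ n - 1 - N, 4N < n and n ≥ 2 follows 4K ≥ 4n - 4 - 4N ≥ 3n - 4 ≥ n.
      (solve 3 (λ K n N → let D = K :- ((n :- con 1ℚ) :- N)
                              E = n :- con (ℕ→ℚ 2)
        in ((D :+ D) :+ (D :+ D)) :+ ((E :+ E) :+ (n :- ((N :+ N) :+ (N :+ N)))) := ((K :+ K) :+ (K :+ K)) :- n)
        refl K (ℕ→ℚ n) N)
      (0≤-+ (0≤-+ (0≤-+ 0≤D 0≤D) (0≤-+ 0≤D 0≤D)) (0≤-+ (0≤-+ 0≤E 0≤E) (p≤q⇒0≤q-p (<⇒≤ 4N<n)))))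
      where
      N : ℚ
      N = neighbours H u
      -- The assumption ε > 1/n enters here: 4εN < 1 < εn.
      4N<n : (N + N) + (N + N) < ℕ→ℚ n
      4N<n = *-cancelˡ-<-nonNeg ε {{nonNegative (<⇒≤ 0<ε)}}
        (subst (_< ε * ℕ→ℚ n) (solve 2 (λ e N → ((e :+ e) :+ (e :+ e)) :* N := e :* ((N :+ N) :+ (N :+ N))) refl ε N)
          (<-trans few 1<εn))
      -- For v ≠ u the left side indicates that `v` is not adjacent to `u`; at v = u it is at most
      -- 0.
      nonneighbour : ∀ v → Dec (v ≡ u) → (1ℚ - δ u v) - adj H u v ≤ 4ε * neighbours H v
      nonneighbour v (yes refl) = ≤-trans (0≤q-p⇒p≤q (subst (0ℚ ≤_)
        (trans (solve 1 (λ a → a := con 0ℚ :- ((con 1ℚ :- con 1ℚ) :- a)) refl (adj H v v))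
          (cong (λ z → 0ℚ - ((1ℚ - z) - adj H v v)) (sym (δ-refl v))))
        (0≤adj H v v))) (0≤4εN v)
      nonneighbour v (no v≢u) =
        [ (λ (_ , a≡1) → ≤-trans (≤-reflexive (cong₂ (λ p q → (1ℚ - p) - q) (δ-≢ v≢u) (cong ℕ→ℚ a≡1))) (0≤4εN v))
        , (λ (w≡0 , a≡0) → ≤-trans (≤-reflexive (cong₂ (λ p q → (1ℚ - p) - q) (δ-≢ v≢u) (cong ℕ→ℚ a≡0)))
            ([ (λ many → contradiction (<-≤-trans few many) (<-irrefl refl)) , (λ many → many) ]′ (nonadjacent⇒many-neighbours (v≢u ∘ sym) w≡0)))
        ]′ (adjacent-cases H u v)
      Σ-nonneighbours : ΣQ n (λ v → (1ℚ - δ u v) - adj H u v) ≡ (ℕ→ℚ n - 1ℚ) - N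
      Σ-nonneighbours = trans (ΣQ-sub n _ (adj H u)) (cong (λ z → z - N) (trans (ΣQ-sub n _ _)
        (cong₂ _-_ (ΣQ-1 n) (trans (ΣQ-cong n (λ v → sym (*-identityʳ (δ u v)))) (ΣQ-δ n u (λ _ → 1ℚ))))))
      0≤D : 0ℚ ≤ K - ((ℕ→ℚ n - 1ℚ) - N)
      0≤D = p≤q⇒0≤q-p (subst₂ _≤_ Σ-nonneighbours (ΣQ-*ˡ n 4ε (neighbours H))
        (ΣQ-mono n (λ v → nonneighbour v (v F.≟ u))))
      0≤E : 0ℚ ≤ ℕ→ℚ n - ℕ→ℚ 2
      0≤E = p≤q⇒0≤q-p 2≤n

  degree-count : n ≥ 2 → ℕ→ℚ n ≤ ΣQ n (neighbours H)
  degree-count n≥2 = subst (_≤ ΣQ n (neighbours H)) (ΣQ-1 n) (ΣQ-mono n (λ u → has-neighbour (proj₂ (other n≥2 u))))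
    where
    other : ∀ {k} → k ≥ 2 → (u : Fin k) → Σ (Fin k) (_≢ u)
    other (ℕ.s≤s (ℕ.s≤s _)) zero    = suc zero , λ ()
    other (ℕ.s≤s (ℕ.s≤s _)) (suc u) = zero , λ ()

-- Edge bounds for small and large ε

1/32 : ℚ
1/32 = ℤ.+ 1 Q./ 32

-- Squaring n/32 ≤ εm gives ε²m² on the right, and ε ≤ 1 absorbs one factor ε. The squared form
-- expresses m ≥ c n/√ε without roots.
small-ε : ∀ {ε n m} → 0ℚ ≤ ε → ε ≤ 1ℚ → 0ℚ ≤ n → 0ℚ ≤ m →
  let K = ((ε + ε) + (ε + ε)) * (m + m) in n ≤ (K + K) + (K + K) →
  (1/32 * 1/32) * (n * n) ≤ ε * (m * m)
small-ε {ε} {n} {m} 0≤ε ε≤1 0≤n 0≤m n≤4K = begin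
  (1/32 * 1/32) * (n * n)    ≡⟨ solve 1 (λ n → (con 1/32 :* con 1/32) :* (n :* n) := (con 1/32 :* n) :* (con 1/32 :* n)) refl n ⟩
  (1/32 * n) * (1/32 * n)    ≤⟨ *-mono-≤-nonNeg (0≤-* (nonNegative⁻¹ 1/32) 0≤n) (0≤-* 0≤ε 0≤m) n/32≤εm n/32≤εm ⟩
  (ε * m) * (ε * m)          ≡⟨ solve 2 (λ e m → (e :* m) :* (e :* m) := e :* (e :* (m :* m))) refl ε m ⟩
  ε * (ε * (m * m))          ≤⟨ *-monoʳ-≤-nonNeg (ε * (m * m)) {{nonNegative (0≤-* 0≤ε (0≤p² m))}} ε≤1 ⟩
  1ℚ * (ε * (m * m))         ≡⟨ *-identityˡ _ ⟩
  ε * (m * m)                ∎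
  where
  open ≤-Reasoning
  K : ℚ
  K = ((ε + ε) + (ε + ε)) * (m + m)
  -- With K = 4ε · 2m the hypothesis says n ≤ 32εm, whence the constant.
  n/32≤εm : 1/32 * n ≤ ε * m
  n/32≤εm = ≤-trans (*-monoˡ-≤-nonNeg 1/32 n≤4K) (≤-reflexive
    (solve 2 (λ e m → let k = ((e :+ e) :+ (e :+ e)) :* (m :+ m) in
      con 1/32 :* ((k :+ k) :+ (k :+ k)) := e :* m) refl ε m))

-- Here n²/4 ≤ m² ≤ εm², and the constant of the other case is smaller than 1/4.
large-ε : ∀ {ε n m} → 1ℚ ≤ ε → 0ℚ ≤ n → 0ℚ ≤ m → n ≤ m + m →
  (1/32 * 1/32) * (n * n) ≤ ε * (m * m)
large-ε {ε} {n} {m} 1≤ε 0≤n 0≤m n≤2m = begin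
  (1/32 * 1/32) * (n * n)    ≤⟨ *-mono-≤-nonNeg (nonNegative⁻¹ (1/32 * 1/32)) (0≤-* 0≤2m 0≤2m) 1/32²≤¼
                                  (*-mono-≤-nonNeg 0≤n 0≤2m n≤2m n≤2m) ⟩
  (½ * ½) * ((m + m) * (m + m)) ≡⟨ solve 1 (λ m → (con ½ :* con ½) :* ((m :+ m) :* (m :+ m)) := con 1ℚ :* (m :* m)) refl m ⟩
  1ℚ * (m * m)               ≤⟨ *-monoʳ-≤-nonNeg (m * m) {{nonNegative (0≤p² m)}} 1≤ε ⟩
  ε * (m * m)                ∎
  where
  open ≤-Reasoning
  0≤2m : 0ℚ ≤ m + m
  0≤2m = 0≤-+ 0≤m 0≤m
  1/32²≤¼ : 1/32 * 1/32 ≤ ½ * ½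
  1/32²≤¼ = toWitness {a? = 1/32 * 1/32 ≤? ½ * ½} _

theorem3p6 : Σ ℚ λ c → (0ℚ < c) ×
    (∀ (n : ℕ) → n ≥ 2 → ∀ (ε : ℚ) → 1ℚ < ε * ℕ→ℚ n →
    Σ (Graph n) λ G → ∀ (H : Graph n) → IsResistanceSparsifier ε G H →
    (c * c) * (ℕ→ℚ n * ℕ→ℚ n) ≤ ε * (ℕ→ℚ (numEdges H) * ℕ→ℚ (numEdges H)))
theorem3p6 = 1/32 , positive⁻¹ 1/32 , λ n n≥2 ε 1<εn → complete n , λ H H-sparsifies →
  let
    2≤n : ℕ→ℚ 2 ≤ ℕ→ℚ n
    2≤n = ℕ→ℚ-mono n≥2
    0<n : 0ℚ < ℕ→ℚ n
    0<n = <-≤-trans (positive⁻¹ (ℕ→ℚ 2)) 2≤n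
    0<ε : 0ℚ < ε
    0<ε = *-cancelʳ-<-nonNeg (ℕ→ℚ n) {{nonNegative (<⇒≤ 0<n)}}
      (subst (_< ε * ℕ→ℚ n) (sym (*-zeroˡ (ℕ→ℚ n))) (<-trans (positive⁻¹ 1ℚ) 1<εn))
    i : ℚ
    i = (1/ ℕ→ℚ n) {{>-nonZero 0<n}}
    0<i : 0ℚ < i
    0<i = positive⁻¹ i {{1/pos⇒pos (ℕ→ℚ n) {{positive 0<n}}}}
    module S = Sparsifier 0<n 0<i (*-inverseʳ (ℕ→ℚ n) {{>-nonZero 0<n}}) 0<ε H H-sparsifies
    0≤m : 0ℚ ≤ ℕ→ℚ (numEdges H)
    0≤m = 0≤ℕ→ℚ (numEdges H)
  -- In both cases `handshake` turns the sum of the neighbour counts into twice the number of edges.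
  in [ (λ ε≤1 → small-ε (<⇒≤ 0<ε) ε≤1 (<⇒≤ 0<n) 0≤m
         (subst (λ M → let K = S.4ε * M in ℕ→ℚ n ≤ (K + K) + (K + K)) (handshake H) (S.edge-count 2≤n 1<εn)))
     , (λ 1≤ε → large-ε 1≤ε (<⇒≤ 0<n) 0≤m (subst (ℕ→ℚ n ≤_) (handshake H) (S.degree-count n≥2)))
     ]′ (≤-total ε 1ℚ)
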